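{- There exists a Sidon set $A$ of positive integers such that $\underline{d}(A+A+A) > 0.064$.
   Context: A set $A$ of positive integers is called a Sidon set if all two-term sums of elements of $A$ are different, i.e. for every positive integer $n$ the equation $a_1+a_2=n$ has at most one solution with $a_1,a_2\in A$, $a_1\le a_2$. The three-fold sumset is $A+A+A=\{a+a'+a'' : a,a',a''\in A\}$ (the elements $a,a',a''$ need not be distinct). For a set $X$ of positive integers, $X(n)$ denotes the number of elements of $X$ not exceeding $n$, and the lower asymptotic density of $X$ is $\underline{d}(X)=\liminf_{n\to\infty}\frac{X(n)}{n}$. -}

module Defs where

open import Level using (0ℓ; suc)
open import Data.List using (length; filter; map; upTo)
open import Data.Nat as ℕ using (ℕ)
open import Data.Integer using (+_)
open import Data.Rational as ℚ using (ℚ)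
import Data.Rational.Properties as ℚ
open import Data.Product using (∃-syntax; _×_; _,_)
open import Relation.Binary.PropositionalEquality using (_≡_)
open import Relation.Unary using (Pred; Decidable; _∈_)

IsPositiveSet : Pred ℕ 0ℓ → Set
IsPositiveSet A = ∀ {a} → a ∈ A → 0 ℕ.< a

IsSidon : Pred ℕ 0ℓ → Set
IsSidon A = ∀ n → 0 ℕ.< n → ∀ {a₁ a₂ b₁ b₂} →
  a₁ ∈ A → a₂ ∈ A → a₁ ℕ.≤ a₂ → a₁ ℕ.+ a₂ ≡ n →
  b₁ ∈ A → b₂ ∈ A → b₁ ℕ.≤ b₂ → b₁ ℕ.+ b₂ ≡ n →
  a₁ ≡ b₁ × a₂ ≡ b₂

ThreefoldSumset : Pred ℕ 0ℓ → Pred ℕ 0ℓ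
ThreefoldSumset A n =
  ∃[ a ] ∃[ a′ ] ∃[ a″ ] a ∈ A × a′ ∈ A × a″ ∈ A × n ≡ a ℕ.+ a′ ℕ.+ a″

-- The counting function X(n) of a set of positive integers: 0 is not counted.
-- Its value does not depend on the choice of decision procedure for X.
count : {X : Pred ℕ 0ℓ} → Decidable X → ℕ → ℕ
count X? n = length (filter X? (map ℕ.suc (upTo n)))

-- An extended real x given by its lower Dedekind cut { q ∈ ℚ ∣ q < x };
-- the empty cut is -∞ and the full cut is +∞.
record LowerReal : Set (suc 0ℓ) where
  field
    cut     : Pred ℚ 0ℓ
    closed  : ∀ {p q} → p ℚ.< q → q ∈ cut → p ∈ cut
    rounded : ∀ {p} → p ∈ cut → ∃[ q ] p ℚ.< q × q ∈ cut

infix 4 _<ᴸ_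

_<ᴸ_ : ℚ → LowerReal → Set
q <ᴸ x = q ∈ LowerReal.cut x

-- liminf u = sup_N inf_{n ≥ N} u n, so q < liminf u iff for some N the tail
-- from N on has a lower bound r > q.  Asking only for q < u n on the tail would
-- be too weak: the infimum could still be q.
liminf : (ℕ → ℚ) → LowerReal
liminf u = record
  { cut     = λ q → ∃[ r ] q ℚ.< r × ∃[ N ] (∀ n → N ℕ.≤ n → r ℚ.≤ u n)
  ; closed  = λ { p<q (r , q<r , tail) → r , ℚ.<-trans p<q q<r , tail }
  ; rounded = λ { (r , p<r , tail) →
      let (q , p<q , q<r) = ℚ.<-dense p<r in q , p<q , r , q<r , tail }
  }

-- The sequence starts at n = 1 to avoid dividing by zero.
lowerDensity : {X : Pred ℕ 0ℓ} → Decidable X → LowerReal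
lowerDensity X? = liminf (λ k → + count X? (ℕ.suc k) ℚ./ ℕ.suc k)

{-# OPTIONS --safe #-}

-- Choose a₀ < a₁ < … greedily with m³ < aₘ ≤ (m+1)³.  At most half of the points of
-- that box violate the Sidon property.  Among the others choose aₘ so that few of
-- the sums aₘ + a_b + a_c with b < c < m equal an earlier sum a_d + a_e + a_h: at most
-- twice the average over the box.  Each equation x + a_b + a_c = a_d + a_e + a_h has
-- one solution x, so the total number of coincidences is controlled by the number of
-- index tuples; up to m < z it is at most z³/27.  On the other hand, the number of
-- triples with sum at most n is asymptotically at least the number of lattice points
-- u < v < w with u³ + v³ + w³ ≤ n, about 0.118 n.  A Riemann sum with mesh 1/50
-- already gives 13434/50³ - 1/27 > 0.07 for the density of the sumset.

module Submission where

open import Defs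
open import Level using (0ℓ)
open import Data.Bool using (if_then_else_; true; false)
open import Data.Integer as ℤ using (+_)
import Data.Integer.Properties as ℤ
open import Data.List as List using ([]; _∷_; _∷ʳ_; filter; length; map; upTo)
open import Data.List.Properties using (filter-++; length-++; map-++; upTo-∷ʳ)
open import Data.Nat hiding (_/_)
open import Data.Nat.Induction using (<-rec)
open import Data.Nat.Properties
open import Data.Nat.Tactic.RingSolver using (solve-∀)
open import Data.Product using (Σ-syntax; ∃-syntax; _×_; _,_; proj₁; proj₂)
open import Data.Rational as ℚ using (_/_)
import Data.Rational.Properties as ℚ
import Data.Rational.Unnormalised as ℚᵘ
import Data.Rational.Unnormalised.Properties as ℚᵘ
open import Function using (_∘_)
open import Relation.Binary using (tri<; tri≈; tri>)
open import Relation.Binary.PropositionalEquality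
open import Relation.Nullary using (Dec; does; yes; no; ¬_; contradiction)
open import Relation.Nullary.Decidable using (_×-dec_; map′; toWitness)
open import Relation.Unary using (Pred; Decidable)

-- Finite sums over initial segments.

∑ : ℕ → (ℕ → ℕ) → ℕ
∑ zero    f = 0
∑ (suc n) f = f n + ∑ n f

∑-cong : ∀ n {f g} → (∀ {i} → i < n → f i ≡ g i) → ∑ n f ≡ ∑ n g
∑-cong zero    f≗g = refl
∑-cong (suc n) f≗g = cong₂ _+_ (f≗g ≤-refl) (∑-cong n (f≗g ∘ m<n⇒m<1+n))

∑-mono : ∀ n {f g} → (∀ {i} → i < n → f i ≤ g i) → ∑ n f ≤ ∑ n g
∑-mono zero    f≤g = z≤n
∑-mono (suc n) f≤g = +-mono-≤ (f≤g ≤-refl) (∑-mono n (f≤g ∘ m<n⇒m<1+n))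

∑-zero : ∀ n → ∑ n (λ _ → 0) ≡ 0
∑-zero zero    = refl
∑-zero (suc n) = ∑-zero n

∑-const : ∀ n k → ∑ n (λ _ → k) ≡ n * k
∑-const zero    k = refl
∑-const (suc n) k = cong (_+_ k) (∑-const n k)

∑-const-≤ : ∀ n {f k} → (∀ {i} → i < n → f i ≤ k) → ∑ n f ≤ n * k
∑-const-≤ n {k = k} f≤k = ≤-trans (∑-mono n f≤k) (≤-reflexive (∑-const n k))

∑-const-≥ : ∀ n {f k} → (∀ {i} → i < n → k ≤ f i) → n * k ≤ ∑ n f
∑-const-≥ n {k = k} k≤f = ≤-trans (≤-reflexive (sym (∑-const n k))) (∑-mono n k≤f)

∑-+ : ∀ n f g → ∑ n (λ i → f i + g i) ≡ ∑ n f + ∑ n g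
∑-+ zero    f g = refl
∑-+ (suc n) f g rewrite ∑-+ n f g = lemma (f n) (g n) (∑ n f) (∑ n g)
  where
  lemma : ∀ a b c d → a + b + (c + d) ≡ a + c + (b + d)
  lemma = solve-∀

∑-*ˡ : ∀ n k f → ∑ n (λ i → k * f i) ≡ k * ∑ n f
∑-*ˡ zero    k f = sym (*-zeroʳ k)
∑-*ˡ (suc n) k f rewrite ∑-*ˡ n k f = sym (*-distribˡ-+ k (f n) (∑ n f))

∑-swap : ∀ m n (f : ℕ → ℕ → ℕ) →
  ∑ m (λ i → ∑ n (λ j → f i j)) ≡ ∑ n (λ j → ∑ m (λ i → f i j))
∑-swap zero    n f = sym (∑-zero n)
∑-swap (suc m) n f rewrite ∑-swap m n f = sym (∑-+ n (f m) (λ j → ∑ m (λ i → f i j)))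

∑-split : ∀ m n f → ∑ (m + n) f ≡ ∑ m f + ∑ n (λ i → f (m + i))
∑-split m zero f rewrite +-identityʳ m = sym (+-identityʳ (∑ m f))
∑-split m (suc n) f rewrite +-suc m n | ∑-split m n f =
  lemma (f (m + n)) (∑ m f) (∑ n (λ i → f (m + i)))
  where
  lemma : ∀ a b c → a + (b + c) ≡ b + (a + c)
  lemma = solve-∀

∑-extend : ∀ {m n} → m ≤ n → ∀ f → ∑ m f ≤ ∑ n f
∑-extend {m} m≤n f with m≤n⇒∃[o]m+o≡n m≤n
... | o , refl rewrite ∑-split m o f = m≤m+n (∑ m f) _

∑-positive : ∀ n {f} → 1 ≤ ∑ n f → ∃[ i ] i < n × 1 ≤ f i
∑-positive (suc n) {f} 1≤∑ with f n in eq
... | suc _ = n , ≤-refl , ≤-trans (s≤s z≤n) (≤-reflexive (sym eq))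
... | zero with ∑-positive n 1≤∑
...   | i , i<n , 1≤fi = i , m<n⇒m<1+n i<n , 1≤fi

term≤∑ : ∀ {n i} → i < n → ∀ f → f i ≤ ∑ n f
term≤∑ {n} {i} i<n f = ≤-trans (m≤m+n (f i) (∑ i f)) (∑-extend i<n f)

-- The support lies among the last `k` indices, and each term is at most 1.
∑-tail : ∀ n k {f} → (∀ {i} → i < n → f i ≤ 1) →
  (∀ {i} → i < n → 1 ≤ f i → n ≤ i + k) → ∑ n f ≤ k
∑-tail zero    k       f≤1 near = z≤n
∑-tail (suc n) zero    {f} f≤1 near with f n in eq
... | zero  = ∑-tail n zero (f≤1 ∘ m<n⇒m<1+n)
  (λ i<n 1≤fi → <⇒≤ (near (m<n⇒m<1+n i<n) 1≤fi))
... | suc _ = contradiction (subst (suc n ≤_) (+-identityʳ n)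
  (near ≤-refl (≤-trans (s≤s z≤n) (≤-reflexive (sym eq))))) (<-irrefl refl)
∑-tail (suc n) (suc k) f≤1 near = +-mono-≤ (f≤1 ≤-refl)
  (∑-tail n k (f≤1 ∘ m<n⇒m<1+n) λ {i} i<n 1≤fi →
    s≤s⁻¹ (≤-trans (near (m<n⇒m<1+n i<n) 1≤fi) (≤-reflexive (+-suc i k))))

-- Zero terms are peeled off from the top. At the largest index of the support, every other support
-- index is within `k` of it, so `∑-tail` applies.
∑-spread : ∀ n k {f} → (∀ {i} → i < n → f i ≤ 1) →
  (∀ {i j} → i < n → j < n → 1 ≤ f i → 1 ≤ f j → j < i + k) → ∑ n f ≤ k
∑-spread zero    k f≤1 near = z≤n
∑-spread (suc n) k {f} f≤1 near with f n in eq
... | zero  = ∑-spread n k (f≤1 ∘ m<n⇒m<1+n)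
  (λ i<n j<n → near (m<n⇒m<1+n i<n) (m<n⇒m<1+n j<n))
... | suc _ = subst (λ y → y + ∑ n f ≤ k) eq (∑-tail (suc n) k f≤1
  λ i<n 1≤fi → near i<n ≤-refl 1≤fi (≤-trans (s≤s z≤n) (≤-reflexive (sym eq))))

∑-unique : ∀ n {f} → (∀ {i} → i < n → f i ≤ 1) →
  (∀ {i j} → i < n → j < n → 1 ≤ f i → 1 ≤ f j → i ≡ j) → ∑ n f ≤ 1
∑-unique n f≤1 unique = ∑-spread n 1 f≤1 λ {i} {j} i<n j<n 1≤fi 1≤fj →
  ≤-trans (s≤s (≤-reflexive (unique j<n i<n 1≤fj 1≤fi))) (≤-reflexive (+-comm 1 i))

-- Indicators of decidable propositions.

-- Branching on `does` keeps evaluation on Booleans, which makes the computation behind `cells-50`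
-- feasible.
ind : {P : Set} → Dec P → ℕ
ind P? = if does P? then 1 else 0

module _ {P : Set} where

  ind≤1 : (P? : Dec P) → ind P? ≤ 1
  ind≤1 (yes _) = ≤-refl
  ind≤1 (no _)  = z≤n

  ind-sound : (P? : Dec P) → 1 ≤ ind P? → P
  ind-sound (yes p) _ = p

  ind-complete : (P? : Dec P) → P → 1 ≤ ind P?
  ind-complete (yes _) _ = ≤-refl
  ind-complete (no ¬p) p = contradiction p ¬p

  ind-bound : (P? : Dec P) {k : ℕ} → (P → 1 ≤ k) → ind P? ≤ k
  ind-bound (yes p) 1≤k = 1≤k p
  ind-bound (no _)  _   = z≤n

ind-mono : {P Q : Set} (P? : Dec P) (Q? : Dec Q) → (P → Q) → ind P? ≤ ind Q?
ind-mono P? Q? P⇒Q = ind-bound P? (ind-complete Q? ∘ P⇒Q)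

≤-by-slack : ∀ {m n} k → m + k ≡ n → m ≤ n
≤-by-slack {m} k refl = m≤m+n m k

-- Cubes and the boxes between them.

cube : ℕ → ℕ
cube m = m * m * m

cube-mono-≤ : ∀ {m n} → m ≤ n → cube m ≤ cube n
cube-mono-≤ m≤n = *-mono-≤ (*-mono-≤ m≤n m≤n) m≤n

cube-cancel-< : ∀ {m n} → cube m < cube n → m < n
cube-cancel-< m³<n³ = ≰⇒> λ n≤m → <⇒≱ m³<n³ (cube-mono-≤ n≤m)

cube-* : ∀ m n → cube (m * n) ≡ cube m * cube n
cube-* = lemma
  where
  lemma : ∀ m n → m * n * (m * n) * (m * n) ≡ m * m * m * (n * n * n)
  lemma = solve-∀

width : ℕ → ℕ
width m = suc (3 * (m * m) + 3 * m)

cube-suc : ∀ m → cube (suc m) ≡ cube m + width m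
cube-suc = lemma
  where
  lemma : ∀ m → suc m * suc m * suc m ≡ m * m * m + suc (3 * (m * m) + 3 * m)
  lemma = solve-∀

width-mono : ∀ {m n} → m ≤ n → width m ≤ width n
width-mono m≤n = s≤s (+-mono-≤ (*-monoʳ-≤ 3 (*-mono-≤ m≤n m≤n)) (*-monoʳ-≤ 3 m≤n))

point : ℕ → ℕ → ℕ
point m t = suc (cube m + t)

InBox : ℕ → ℕ → Set
InBox m x = cube m < x × x ≤ cube (suc m)

point-inBox : ∀ m {t} → t < width m → InBox m (point m t)
point-inBox m {t} t<w = s≤s (m≤m+n (cube m) t) ,
  ≤-trans (≤-reflexive (sym (+-suc (cube m) t)))
    (≤-trans (+-monoʳ-≤ (cube m) t<w) (≤-reflexive (sym (cube-suc m))))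

inBox-mono-< : ∀ {i j x y} → InBox i x → InBox j y → i < j → x < y
inBox-mono-< (_ , x≤) (<y , _) i<j = ≤-<-trans x≤ (≤-<-trans (cube-mono-≤ i<j) <y)

Boxed : ℕ → (ℕ → ℕ) → Set
Boxed m f = ∀ {i} → i < m → InBox i (f i)

-- Conflicts and overlaps of a candidate.

-- The condition `b ≤ c` is part of the predicate because `∑` ranges over initial segments only;
-- `d < b` is built into the range.
conflict? : ∀ (f : ℕ → ℕ) x d b c → Dec (b ≤ c × f d + x ≡ f b + f c)
conflict? f x d b c = (b ≤? c) ×-dec (f d + x ≟ f b + f c)

conflicts : (ℕ → ℕ) → ℕ → ℕ → ℕ
conflicts f m x = ∑ m λ b → ∑ b λ d → ∑ m λ c → ind (conflict? f x d b c)

overlap? : ∀ (f : ℕ → ℕ) x c h b e d → Dec (x + (f b + f c) ≡ f d + f e + f h)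
overlap? f x c h b e d = x + (f b + f c) ≟ f d + f e + f h

-- The top indices `c` and `h` stay parameters, so that the sum over them can be regrouped by their
-- maximum.
overlapsAt : (ℕ → ℕ) → ℕ → ℕ → ℕ → ℕ
overlapsAt f x c h = ∑ c λ b → ∑ h λ e → ∑ e λ d → ind (overlap? f x c h b e d)

overlaps : (ℕ → ℕ) → ℕ → ℕ → ℕ
overlaps f m x = ∑ m λ c → ∑ m λ h → overlapsAt f x c h

totalOverlaps : (ℕ → ℕ) → ℕ → ℕ
totalOverlaps f m = ∑ (width m) λ t → overlaps f m (point m t)

-- Only values below `m` enter. This lets the finite `prefix m` be exchanged for the whole sequence
-- `a`; the same holds for overlaps.
conflicts-cong : ∀ m x {f g : ℕ → ℕ} → (∀ {i} → i < m → f i ≡ g i) → conflicts f m x ≡ conflicts g m x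
conflicts-cong m x {f} {g} f≗g = ∑-cong m λ {b} b<m → ∑-cong b λ {d} d<b → ∑-cong m λ {c} c<m →
  lemma b c (f≗g (<-trans d<b b<m)) (f≗g b<m) (f≗g c<m)
  where
  lemma : ∀ b c {d} → f d ≡ g d → f b ≡ g b → f c ≡ g c → ind (conflict? f x d b c) ≡ ind (conflict? g x d b c)
  lemma b c p q r rewrite p | q | r = refl

overlaps-cong : ∀ m x {f g : ℕ → ℕ} → (∀ {i} → i < m → f i ≡ g i) → overlaps f m x ≡ overlaps g m x
overlaps-cong m x {f} {g} f≗g =
  ∑-cong m λ {c} c<m → ∑-cong m λ {h} h<m → ∑-cong c λ {b} b<c → ∑-cong h λ {e} e<h → ∑-cong e λ {d} d<e →
  let e<m = <-trans e<h h<m in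
  lemma c h b e d (f≗g c<m) (f≗g h<m) (f≗g (<-trans b<c c<m)) (f≗g e<m) (f≗g (<-trans d<e e<m))
  where
  lemma : ∀ c h b e d → f c ≡ g c → f h ≡ g h → f b ≡ g b → f e ≡ g e → f d ≡ g d →
    ind (overlap? f x c h b e d) ≡ ind (overlap? g x c h b e d)
  lemma c h b e d p q r s t rewrite p | q | r | s | t = refl

-- Conflicts are the x excluded by the Sidon property: x = f b + f c ∸ f d with d < b ≤ c.
-- As f c ≥ x / 2, the index c is so large that the boxes near c have width
-- at least width m / 2; hence a pair d < b admits at most 3 values of c.
4n>3m : ∀ m n → cube m < 2 * cube n → 3 * m < 4 * n
4n>3m m n m³<2n³ = cube-cancel-< (begin-strict
  cube (3 * m)    ≡⟨ cube-* 3 m ⟩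
  -- The room between 27 and 32 comes from (4/3)³ = 64/27 > 2.
  27 * cube m     ≤⟨ *-monoˡ-≤ (cube m) (m≤m+n 27 5) ⟩
  32 * cube m     <⟨ *-monoʳ-< 32 m³<2n³ ⟩
  32 * (2 * cube n) ≡⟨ *-assoc 32 2 (cube n) ⟨
  64 * cube n     ≡⟨ cube-* 4 n ⟨
  cube (4 * n)    ∎)
  where open ≤-Reasoning

-- The two boxes following n³ have total width 6n² + 12n + 8. From 3m < 4n come 3m² ≤ 16n²/3 ≤ 6n²
-- and 3m ≤ 4n.
width<gap : ∀ m n → 3 * m < 4 * n → cube n + width m ≤ cube (2 + n)
width<gap m n 3m<4n = *-cancelˡ-≤ 8 (begin
  8 * (cube n + width m)                            ≡⟨ expand₁ m n ⟩
  8 * cube n + (24 * (m * m) + 24 * m + 8)          ≤⟨ +-monoʳ-≤ (8 * cube n) (+-monoˡ-≤ 8 (+-mono-≤ sq lin)) ⟩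
  8 * cube n + (48 * (n * n) + 32 * n + 8)          ≤⟨ ≤-by-slack (64 * n + 56) (expand₂ n) ⟩
  8 * cube (2 + n)                                  ∎)
  where
  open ≤-Reasoning
  expand₁ : ∀ m n → 8 * (n * n * n + suc (3 * (m * m) + 3 * m)) ≡ 8 * (n * n * n) + (24 * (m * m) + 24 * m + 8)
  expand₁ = solve-∀
  expand₂ : ∀ n → 8 * (n * n * n) + (48 * (n * n) + 32 * n + 8) + (64 * n + 56) ≡ 8 * ((2 + n) * (2 + n) * (2 + n))
  expand₂ = solve-∀
  3m≤4n = <⇒≤ 3m<4n
  lin : 24 * m ≤ 32 * n
  lin = begin
    24 * m       ≡⟨ *-assoc 8 3 m ⟩
    8 * (3 * m)  ≤⟨ *-monoʳ-≤ 8 3m≤4n ⟩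
    8 * (4 * n)  ≡⟨ *-assoc 8 4 n ⟨
    32 * n       ∎
  sq : 24 * (m * m) ≤ 48 * (n * n)
  sq = *-cancelˡ-≤ 3 (begin
    3 * (24 * (m * m))      ≡⟨ r₁ m ⟩
    8 * (3 * m * (3 * m))   ≤⟨ *-monoʳ-≤ 8 (*-mono-≤ 3m≤4n 3m≤4n) ⟩
    8 * (4 * n * (4 * n))   ≤⟨ ≤-by-slack (16 * (n * n)) (r₂ n) ⟩
    3 * (48 * (n * n))      ∎)
    where
    r₁ : ∀ m → 3 * (24 * (m * m)) ≡ 8 * (3 * m * (3 * m))
    r₁ = solve-∀
    r₂ : ∀ n → 8 * (4 * n * (4 * n)) + 16 * (n * n) ≡ 3 * (48 * (n * n))
    r₂ = solve-∀

∑-id : ∀ n → 2 * ∑ n (λ i → i) + n ≡ n * n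
∑-id zero = refl
∑-id (suc n) = trans (lemma n (∑ n λ i → i)) (trans (cong (λ s → s + 2 * n + 1) (∑-id n)) (lemma′ n))
  where
  lemma : ∀ n s → 2 * (n + s) + suc n ≡ 2 * s + n + 2 * n + 1
  lemma = solve-∀
  lemma′ : ∀ n → n * n + 2 * n + 1 ≡ suc n * suc n
  lemma′ = solve-∀

-- Counting the conflicts within one box.

module _ {m : ℕ} {f : ℕ → ℕ} (boxed : Boxed m f) where

  boxed-cancel-≤ : ∀ {i j} → i < m → j < m → f i ≤ f j → i ≤ j
  boxed-cancel-≤ i<m j<m fi≤fj = ≮⇒≥ λ j<i → <⇒≱ (inBox-mono-< (boxed j<m) (boxed i<m) j<i) fi≤fj

  boxed-mono-≤ : ∀ {i j} → j < m → i ≤ j → f i ≤ f j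
  boxed-mono-≤ {i} {j} j<m i≤j = ≮⇒≥ λ fj<fi →
    <⇒≱ fj<fi (≤-reflexive (cong f (≤-antisym i≤j (boxed-cancel-≤ j<m (≤-<-trans i≤j j<m) (<⇒≤ fj<fi)))))

  private
    hit : ℕ → ℕ → ℕ → ℕ → ℕ
    hit b d c t = ind (conflict? f (point m t) d b c)

  conflict-index : ∀ {b d c t} → c < m → d < b → 1 ≤ hit b d c t → 3 * m < 4 * suc c
  conflict-index {b} {d} {c} {t} c<m d<b 1≤hit with ind-sound (conflict? f (point m t) d b c) 1≤hit
  ... | b≤c , eq = 4n>3m m (suc c) (begin-strict
    cube m            <⟨ s≤s (m≤m+n (cube m) t) ⟩
    point m t         ≤⟨ m≤n+m (point m t) (f d) ⟩
    f d + point m t   ≡⟨ eq ⟩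
    f b + f c         ≤⟨ +-monoˡ-≤ (f c) (boxed-mono-≤ c<m b≤c) ⟩
    f c + f c         ≤⟨ +-mono-≤ (proj₂ (boxed c<m)) (proj₂ (boxed c<m)) ⟩
    cube (suc c) + cube (suc c) ≡⟨ cong (_+_ (cube (suc c))) (+-identityʳ (cube (suc c))) ⟨
    2 * cube (suc c)  ∎)
    where open ≤-Reasoning

  -- For fixed `b` and `d`, `f c′` and `f c` differ by as much as the two candidates, hence by less
  -- than the width of their box. Three steps in the index would leave two whole boxes in between,
  -- which is too much by `width<gap`.
  conflict-close : ∀ {b d c c′ t t′} → d < b → c < m → c′ < m → t′ < width m →
    1 ≤ hit b d c t → 1 ≤ hit b d c′ t′ → c′ < c + 3
  conflict-close {b} {d} {c} {c′} {t} {t′} d<b c<m c′<m t′<w hit₁ hit₂ = ≰⇒> λ c+3≤c′ → <-irrefl refl (begin-strict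
    f b + f c + width m             ≤⟨ +-monoˡ-≤ (width m) (+-monoʳ-≤ (f b) (proj₂ (boxed c<m))) ⟩
    f b + cube (suc c) + width m    ≡⟨ +-assoc (f b) (cube (suc c)) (width m) ⟩
    f b + (cube (suc c) + width m)  ≤⟨ +-monoʳ-≤ (f b) (width<gap m (suc c) (conflict-index c<m d<b hit₁)) ⟩
    f b + cube (3 + c)              ≤⟨ +-monoʳ-≤ (f b) (cube-mono-≤ (≤-trans (≤-reflexive (+-comm 3 c)) c+3≤c′)) ⟩
    f b + cube c′                   <⟨ +-monoʳ-< (f b) (proj₁ (boxed c′<m)) ⟩
    f b + f c′                      ≡⟨ proj₂ (ind-sound (conflict? f (point m t′) d b c′) hit₂) ⟨
    f d + point m t′                ≤⟨ +-monoʳ-≤ (f d) (s≤s (+-monoʳ-≤ (cube m) (<⇒≤ t′<w))) ⟩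
    f d + suc (cube m + width m)    ≤⟨ +-monoʳ-≤ (f d) (s≤s (+-monoˡ-≤ (width m) (m≤m+n (cube m) t))) ⟩
    f d + (point m t + width m)     ≡⟨ +-assoc (f d) (point m t) (width m) ⟨
    f d + point m t + width m       ≡⟨ cong (_+ width m) (proj₂ (ind-sound (conflict? f (point m t) d b c) hit₁)) ⟩
    f b + f c + width m             ∎)
    where open ≤-Reasoning

  -- For each `c` the equation determines `t`, and `conflict-close` confines the productive `c` to a
  -- window of three.
  conflicts-per-pair : ∀ {b d} → d < b → ∑ m (λ c → ∑ (width m) (hit b d c)) ≤ 3
  conflicts-per-pair {b} {d} d<b = ∑-spread m 3
    (λ {c} _ → ∑-unique (width m) (λ {t} _ → ind≤1 (conflict? f (point m t) d b c))
      λ {t} {t′} _ _ h h′ → +-cancelˡ-≡ (cube m) t t′ (suc-injective (+-cancelˡ-≡ (f d) _ _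
        (trans (proj₂ (ind-sound (conflict? f (point m t) d b c) h))
               (sym (proj₂ (ind-sound (conflict? f (point m t′) d b c) h′)))))))
    λ {c} {c′} c<m c′<m p p′ →
      let t  , _    , h  = ∑-positive (width m) p
          t′ , t′<w , h′ = ∑-positive (width m) p′
      in conflict-close d<b c<m c′<m t′<w h h′

  -- There are at most m²/2 pairs `d < b`, each with at most 3 conflicts, against more than 3m²
  -- points in the box. Hence at most half of these points have a conflict.
  totalConflicts : 2 * ∑ (width m) (λ t → conflicts f m (point m t)) ≤ width m
  totalConflicts = begin
    2 * ∑ (width m) (λ t → conflicts f m (point m t))
      ≡⟨ cong (2 *_) reorder ⟩
    2 * ∑ m (λ b → ∑ b λ d → ∑ m λ c → ∑ (width m) (hit b d c))
      ≤⟨ *-monoʳ-≤ 2 (∑-mono m λ {b} _ → ∑-const-≤ b conflicts-per-pair) ⟩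
    2 * ∑ m (λ b → b * 3)
      ≡⟨ cong (2 *_) (trans (∑-cong m λ {b} _ → *-comm b 3) (∑-*ˡ m 3 λ b → b)) ⟩
    2 * (3 * ∑ m (λ b → b))
      ≡⟨ lemma (∑ m λ b → b) ⟩
    3 * (2 * ∑ m (λ b → b))
      ≤⟨ *-monoʳ-≤ 3 (≤-by-slack m (∑-id m)) ⟩
    3 * (m * m)
      ≤⟨ ≤-by-slack (3 * m + 1) (trans (sym (+-assoc (3 * (m * m)) (3 * m) 1)) (+-comm _ 1)) ⟩
    width m
      ∎
    where
    open ≤-Reasoning
    lemma : ∀ s → 2 * (3 * s) ≡ 3 * (2 * s)
    lemma = solve-∀
    reorder : ∑ (width m) (λ t → conflicts f m (point m t)) ≡ ∑ m (λ b → ∑ b λ d → ∑ m λ c → ∑ (width m) (hit b d c))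
    reorder = trans (∑-swap (width m) m λ t b → ∑ b λ d → ∑ m λ c → hit b d c t)
      (∑-cong m λ {b} _ → trans (∑-swap (width m) b λ t d → ∑ m λ c → hit b d c t)
        (∑-cong b λ {d} _ → ∑-swap (width m) m λ t c → hit b d c t))

-- The greedy choice.

-- The second clause is "at most twice the average over the box", cleared of denominators.
Good : (ℕ → ℕ) → ℕ → ℕ → Set
Good f m t = conflicts f m (point m t) ≡ 0 × width m * overlaps f m (point m t) ≤ 2 * totalOverlaps f m

good? : ∀ f m t → Dec (Good f m t)
good? f m t = (conflicts f m (point m t) ≟ 0) ×-dec (width m * overlaps f m (point m t) ≤? 2 * totalOverlaps f m)

-- Otherwise 2 s + 1 ≤ (2 s + 1) * C t + n * V t for every t, with s = ∑ n V;
-- summing over t gives n * (4 s + 2) ≤ n * (4 s + 1).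
cheap-index : ∀ n {C V : ℕ → ℕ} → 0 < n → 2 * ∑ n C ≤ n → ∃[ t ] t < n × C t ≡ 0 × n * V t ≤ 2 * ∑ n V
cheap-index n {C} {V} 0<n 2C≤n with anyUpTo? (λ t → (C t ≟ 0) ×-dec (n * V t ≤? 2 * ∑ n V)) n
... | yes found = found
... | no none   = contradiction (begin-strict
    n * (4 * s + 1)                              <⟨ *-monoʳ-< n {{>-nonZero 0<n}} (≤-reflexive (sym (+-suc (4 * s) 1))) ⟩
    n * (4 * s + 2)                              ≡⟨ r₁ n s ⟩
    2 * (n * (2 * s + 1))                        ≤⟨ *-monoʳ-≤ 2 (∑-const-≥ n cost) ⟩
    2 * ∑ n (λ t → (2 * s + 1) * C t + n * V t)  ≡⟨ cong (2 *_) (∑-+ n (λ t → (2 * s + 1) * C t) (λ t → n * V t)) ⟩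
    2 * (∑ n (λ t → (2 * s + 1) * C t) + ∑ n (λ t → n * V t))
                                                 ≡⟨ cong (2 *_) (cong₂ _+_ (∑-*ˡ n (2 * s + 1) C) (∑-*ˡ n n V)) ⟩
    2 * ((2 * s + 1) * ∑ n C + n * s)            ≡⟨ r₂ n s (∑ n C) ⟩
    (2 * s + 1) * (2 * ∑ n C) + 2 * (n * s)      ≤⟨ +-monoˡ-≤ (2 * (n * s)) (*-monoʳ-≤ (2 * s + 1) 2C≤n) ⟩
    (2 * s + 1) * n + 2 * (n * s)                ≡⟨ r₃ n s ⟩
    n * (4 * s + 1)                              ∎) (<-irrefl refl)
  where
  open ≤-Reasoning
  s = ∑ n V
  r₁ : ∀ n s → n * (4 * s + 2) ≡ 2 * (n * (2 * s + 1))
  r₁ = solve-∀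
  r₂ : ∀ n s c → 2 * ((2 * s + 1) * c + n * s) ≡ (2 * s + 1) * (2 * c) + 2 * (n * s)
  r₂ = solve-∀
  r₃ : ∀ n s → (2 * s + 1) * n + 2 * (n * s) ≡ n * (4 * s + 1)
  r₃ = solve-∀
  cost : ∀ {t} → t < n → 2 * s + 1 ≤ (2 * s + 1) * C t + n * V t
  cost {t} t<n with C t in eq
  ... | suc c = ≤-trans (m≤m*n (2 * s + 1) (suc c)) (m≤m+n _ (n * V t))
  ... | zero  = ≤-trans (≤-trans (≤-reflexive (+-comm (2 * s) 1)) (≰⇒> λ few → none (t , t<n , eq , few)))
    (m≤n+m (n * V t) ((2 * s + 1) * 0))

good-exists : ∀ {m f} → Boxed m f → ∃[ t ] t < width m × Good f m t
good-exists {m} boxed = cheap-index (width m) (s≤s z≤n) (totalConflicts boxed)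

abstract

  -- Abstract, so that type checking never runs the search. The default 0 cannot occur for boxed
  -- sequences, by `good-exists`.
  choose : (ℕ → ℕ) → ℕ → ℕ
  choose f m with anyUpTo? (good? f m) (width m)
  ... | yes (t , _) = point m t
  ... | no  _       = 0

  choose-good : ∀ {m f} → Boxed m f → ∃[ t ] t < width m × Good f m t × choose f m ≡ point m t
  choose-good {m} {f} boxed with anyUpTo? (good? f m) (width m)
  ... | yes (t , t<w , good) = t , t<w , good , refl
  ... | no none              = contradiction (good-exists boxed) none

-- The sequence and its Sidon property.

-- Course-of-values recursion in structural form: `prefix m` stores the first `m` terms and is 0
-- beyond them.
prefix : ℕ → ℕ → ℕ
prefix zero    i = 0
prefix (suc m) i with i ≟ m
... | yes _ = choose (prefix m) m
... | no  _ = prefix m i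

a : ℕ → ℕ
a m = choose (prefix m) m

prefix-a : ∀ m {i} → i < m → prefix m i ≡ a i
prefix-a (suc m) {i} i<1+m with i ≟ m
... | yes refl = refl
... | no i≢m   = prefix-a m (≤∧≢⇒< (s≤s⁻¹ i<1+m) i≢m)

-- By strong induction the earlier terms lie in their boxes, so a good candidate exists for
-- `prefix m`. Its properties carry over to `a`, which agrees with `prefix m` below `m`.
a-choice : ∀ m → ∃[ t ] t < width m × a m ≡ point m t × Good a m t
a-choice = <-rec _ step
  where
  step : ∀ m → (∀ {i} → i < m → ∃[ t ] t < width i × a i ≡ point i t × Good a i t) →
    ∃[ t ] t < width m × a m ≡ point m t × Good a m t
  step m ih with choose-good {m} {prefix m} boxed
    where
    boxed : Boxed m (prefix m)
    boxed {i} i<m with ih i<m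
    ... | t , t<w , eq , _ = subst (InBox i) (sym (trans (prefix-a m i<m) eq)) (point-inBox i t<w)
  ... | t , t<w , (noConflict , fewOverlaps) , eq = t , t<w , eq ,
    trans (sym (conflicts-cong m (point m t) (prefix-a m))) noConflict ,
    subst₂ _≤_ (cong (width m *_) (overlaps-cong m (point m t) (prefix-a m)))
      (cong (2 *_) (∑-cong (width m) λ {t} _ → overlaps-cong m (point m t) (prefix-a m))) fewOverlaps

a-inBox : ∀ m → InBox m (a m)
a-inBox m = let t , t<w , eq , _ = a-choice m in subst (InBox m) (sym eq) (point-inBox m t<w)

a-boxed : ∀ m → Boxed m a
a-boxed m {i} _ = a-inBox i

a-noConflict : ∀ m → conflicts a m (a m) ≡ 0
a-noConflict m = let t , _ , eq , none , _ = a-choice m in trans (cong (conflicts a m) eq) none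

a-fewOverlaps : ∀ m → width m * overlaps a m (a m) ≤ 2 * totalOverlaps a m
a-fewOverlaps m = let t , _ , eq , _ , few = a-choice m in
  subst (λ x → width m * overlaps a m x ≤ 2 * totalOverlaps a m) (sym eq) few

a-mono-< : ∀ {i j} → i < j → a i < a j
a-mono-< {i} {j} = inBox-mono-< (a-inBox i) (a-inBox j)

a-mono-≤ : ∀ {i j} → i ≤ j → a i ≤ a j
a-mono-≤ {j = j} = boxed-mono-≤ (a-boxed (suc j)) ≤-refl

a-cancel-< : ∀ {i j} → a i < a j → i < j
a-cancel-< {i} {j} ai<aj = ≰⇒> λ j≤i → <⇒≱ ai<aj (a-mono-≤ j≤i)

a-cancel-≤ : ∀ {i j} → a i ≤ a j → i ≤ j
a-cancel-≤ {i} {j} ai≤aj = ≮⇒≥ λ j<i → <⇒≱ (a-mono-< j<i) ai≤aj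

a-injective : ∀ {i j} → a i ≡ a j → i ≡ j
a-injective eq = ≤-antisym (a-cancel-≤ (≤-reflexive eq)) (a-cancel-≤ (≤-reflexive (sym eq)))

conflict-free : ∀ {d b c m} → d < b → b ≤ c → c < m → a d + a m ≢ a b + a c
conflict-free {d} {b} {c} {m} d<b b≤c c<m eq = contradiction (begin
  1                                                              ≤⟨ ind-complete (conflict? a (a m) d b c) (b≤c , eq) ⟩
  ind (conflict? a (a m) d b c)                                  ≤⟨ term≤∑ c<m (λ c → ind (conflict? a (a m) d b c)) ⟩
  ∑ m (λ c → ind (conflict? a (a m) d b c))                      ≤⟨ term≤∑ d<b (λ d → ∑ m λ c → ind (conflict? a (a m) d b c)) ⟩
  ∑ b (λ d → ∑ m λ c → ind (conflict? a (a m) d b c))            ≤⟨ term≤∑ (≤-<-trans b≤c c<m) (λ b → ∑ b λ d → ∑ m λ c → ind (conflict? a (a m) d b c)) ⟩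
  conflicts a m (a m)                                            ≡⟨ a-noConflict m ⟩
  0                                                              ∎) λ ()
  where open ≤-Reasoning

-- As `a l` exceeds `a j`, equality forces `a k < a i`, and the equation becomes a conflict that was
-- excluded when `a l` was chosen.
sidon-< : ∀ {i j k l} → i ≤ j → j < l → a i + a j ≢ a k + a l
sidon-< {i} {j} {k} {l} i≤j j<l eq = conflict-free (a-cancel-< ak<ai) i≤j j<l (sym eq)
  where
  ak<ai : a k < a i
  ak<ai = ≰⇒> λ ai≤ak → <⇒≢ (+-mono-≤-< ai≤ak (a-mono-< j<l)) eq

a-sidon : ∀ {i j k l} → i ≤ j → k ≤ l → a i + a j ≡ a k + a l → i ≡ k × j ≡ l
a-sidon {i} {j} {k} {l} i≤j k≤l eq with <-cmp j l
... | tri< j<l _ _    = contradiction eq (sidon-< i≤j j<l)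
... | tri> _ _ l<j    = contradiction (sym eq) (sidon-< k≤l l<j)
... | tri≈ _ refl _   = a-injective (+-cancelʳ-≡ (a j) (a i) (a k) eq) , refl

-- Regrouping sums, and leading-order bounds for numbers of index tuples.

-- Shifted down by one, the boxes with `m < z` tile the numbers below z³.
∑-boxes : ∀ z G → ∑ z (λ m → ∑ (width m) λ t → G (cube m + t)) ≡ ∑ (cube z) G
∑-boxes zero    G = refl
∑-boxes (suc z) G = begin
  ∑ (width z) (λ t → G (cube z + t)) + ∑ z (λ m → ∑ (width m) λ t → G (cube m + t))
    ≡⟨ cong (_+_ (∑ (width z) (λ t → G (cube z + t)))) (∑-boxes z G) ⟩
  ∑ (width z) (λ t → G (cube z + t)) + ∑ (cube z) G
    ≡⟨ +-comm _ (∑ (cube z) G) ⟩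
  ∑ (cube z) G + ∑ (width z) (λ t → G (cube z + t))
    ≡⟨ ∑-split (cube z) (width z) G ⟨
  ∑ (cube z + width z) G
    ≡⟨ cong (λ n → ∑ n G) (cube-suc z) ⟨
  ∑ (cube (suc z)) G
    ∎
  where open ≡-Reasoning

-- Pairs are grouped by their maximum `g`: corner, column and row of an L-shaped layer.
∑-square : ∀ m (φ : ℕ → ℕ → ℕ) →
  ∑ m (λ c → ∑ m λ h → φ c h) ≡ ∑ m (λ g → φ g g + ∑ g (λ c → φ c g) + ∑ g (λ h → φ g h))
∑-square zero    φ = refl
∑-square (suc m) φ = begin
  φ m m + ∑ m (φ m) + ∑ m (λ c → φ c m + ∑ m (φ c))
    ≡⟨ cong (_+_ (φ m m + ∑ m (φ m))) (∑-+ m (λ c → φ c m) (λ c → ∑ m (φ c))) ⟩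
  φ m m + ∑ m (φ m) + (∑ m (λ c → φ c m) + ∑ m (λ c → ∑ m (φ c)))
    ≡⟨ lemma (φ m m) (∑ m (φ m)) (∑ m λ c → φ c m) (∑ m λ c → ∑ m (φ c)) ⟩
  φ m m + ∑ m (λ c → φ c m) + ∑ m (φ m) + ∑ m (λ c → ∑ m (φ c))
    ≡⟨ cong (_+_ (φ m m + ∑ m (λ c → φ c m) + ∑ m (φ m))) (∑-square m φ) ⟩
  φ m m + ∑ m (λ c → φ c m) + ∑ m (φ m) + ∑ m (λ g → φ g g + ∑ g (λ c → φ c g) + ∑ g (λ h → φ g h))
    ∎
  where
  open ≡-Reasoning
  lemma : ∀ p q r s → p + q + (r + s) ≡ p + r + q + s
  lemma = solve-∀

-- Meant for an equation that determines `i`: its solution, if any, is charged to a condition free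
-- of `i`.
∑-charge : ∀ n {P : ℕ → Set} {Q : Set} (P? : ∀ i → Dec (P i)) (Q? : Dec Q) →
  (∀ {i} → P i → Q) → (∀ {i j} → P i → P j → i ≡ j) → ∑ n (λ i → ind (P? i)) ≤ ind Q?
∑-charge n P? (yes _) P⇒Q unique = ∑-unique n (λ {i} _ → ind≤1 (P? i))
  λ {i} {j} _ _ p q → unique (ind-sound (P? i) p) (ind-sound (P? j) q)
∑-charge n P? (no ¬q) P⇒Q unique = ≤-trans
  (∑-mono n λ {i} _ → ind-bound (P? i) λ p → contradiction (P⇒Q p) ¬q) (≤-reflexive (∑-zero n))

∑-ind-< : ∀ n d → ∑ n (λ b → ind (b <? d)) ≤ d
∑-ind-< n d = ∑-spread n d (λ {b} _ → ind≤1 (b <? d))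
  λ {i} {j} _ _ _ j<d → ≤-trans (ind-sound (j <? d) j<d) (m≤n+m d i)

ind-asym : ∀ {P Q : Set} (P? : Dec P) (Q? : Dec Q) → (P → ¬ Q) → ind P? + ind Q? ≤ 1
ind-asym (yes p) (yes q) P⇒¬Q = contradiction q (P⇒¬Q p)
ind-asym (yes _) (no _)  _    = ≤-refl
ind-asym (no _)  Q?      _    = ind≤1 Q?

∑-squares : ∀ n → 3 * ∑ n (λ i → i * i) ≤ cube n
∑-squares zero    = z≤n
∑-squares (suc n) = begin
  3 * (n * n + ∑ n (λ i → i * i))    ≡⟨ *-distribˡ-+ 3 (n * n) _ ⟩
  3 * (n * n) + 3 * ∑ n (λ i → i * i) ≤⟨ +-monoʳ-≤ (3 * (n * n)) (∑-squares n) ⟩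
  3 * (n * n) + cube n               ≤⟨ ≤-by-slack (3 * n + 1) (lemma n) ⟩
  cube (suc n)                       ∎
  where
  open ≤-Reasoning
  lemma : ∀ n → 3 * (n * n) + n * n * n + (3 * n + 1) ≡ suc n * suc n * suc n
  lemma = solve-∀

∑-cubes : ∀ n → 4 * ∑ n cube ≤ n * n * (n * n)
∑-cubes zero    = z≤n
∑-cubes (suc n) = begin
  4 * (cube n + ∑ n cube)        ≡⟨ *-distribˡ-+ 4 (cube n) _ ⟩
  4 * cube n + 4 * ∑ n cube      ≤⟨ +-monoʳ-≤ (4 * cube n) (∑-cubes n) ⟩
  4 * cube n + n * n * (n * n)   ≤⟨ ≤-by-slack (6 * (n * n) + 4 * n + 1) (lemma n) ⟩
  suc n * suc n * (suc n * suc n) ∎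
  where
  open ≤-Reasoning
  lemma : ∀ n → 4 * (n * n * n) + n * n * (n * n) + (6 * (n * n) + 4 * n + 1) ≡ suc n * suc n * (suc n * suc n)
  lemma = solve-∀

∑-triangle : ∀ n → 2 * ∑ n (λ i → i) ≤ n * n
∑-triangle n = ≤-by-slack n (∑-id n)

∑-scale-mono : ∀ n k {f g} → (∀ i → k * f i ≤ g i) → k * ∑ n f ≤ ∑ n g
∑-scale-mono n k {f} kf≤g = ≤-trans (≤-reflexive (sym (∑-*ˡ n k f))) (∑-mono n λ {i} _ → kf≤g i)

-- The sum counts triples `b < d < e` below `n`; `∑-triples` does the same for quadruples.
∑-pairs : ∀ n → 6 * ∑ n (λ e → ∑ e λ d → d) ≤ cube n
∑-pairs n = begin
  6 * ∑ n (λ e → ∑ e λ d → d)        ≡⟨ *-assoc 3 2 (∑ n λ e → ∑ e λ d → d) ⟩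
  3 * (2 * ∑ n (λ e → ∑ e λ d → d))  ≤⟨ *-monoʳ-≤ 3 (∑-scale-mono n 2 ∑-triangle) ⟩
  3 * ∑ n (λ e → e * e)              ≤⟨ ∑-squares n ⟩
  cube n                             ∎
  where open ≤-Reasoning

∑-triples : ∀ n → 24 * ∑ n (λ h → ∑ h λ e → ∑ e λ d → d) ≤ n * n * (n * n)
∑-triples n = begin
  24 * ∑ n (λ h → ∑ h λ e → ∑ e λ d → d)       ≡⟨ *-assoc 4 6 (∑ n λ h → ∑ h λ e → ∑ e λ d → d) ⟩
  4 * (6 * ∑ n (λ h → ∑ h λ e → ∑ e λ d → d))  ≤⟨ *-monoʳ-≤ 4 (∑-scale-mono n 6 ∑-pairs) ⟩
  4 * ∑ n cube                                 ≤⟨ ∑-cubes n ⟩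
  n * n * (n * n)                              ∎
  where open ≤-Reasoning

-- Bounding the total number of overlaps.

smallerPairs : ℕ → ℕ → ℕ
smallerPairs g c = ∑ c λ b → ∑ g λ e → ∑ e λ d → ind (a b + a c <? a d + a e)

∑²-swap : ∀ g (φ : ℕ → ℕ → ℕ → ℕ → ℕ) →
  ∑ g (λ c → ∑ c λ b → ∑ g λ e → ∑ e λ d → φ b c d e) ≡ ∑ g (λ e → ∑ e λ d → ∑ g λ c → ∑ c λ b → φ b c d e)
∑²-swap g φ = begin
  ∑ g (λ c → ∑ c λ b → ∑ g λ e → ∑ e λ d → φ b c d e)
    ≡⟨ ∑-cong g (λ {c} _ → ∑-swap c g λ b e → ∑ e λ d → φ b c d e) ⟩
  ∑ g (λ c → ∑ g λ e → ∑ c λ b → ∑ e λ d → φ b c d e)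
    ≡⟨ ∑-swap g g (λ c e → ∑ c λ b → ∑ e λ d → φ b c d e) ⟩
  ∑ g (λ e → ∑ g λ c → ∑ c λ b → ∑ e λ d → φ b c d e)
    ≡⟨ ∑-cong g (λ {e} _ → ∑-cong g λ {c} _ → ∑-swap c e λ b d → φ b c d e) ⟩
  ∑ g (λ e → ∑ g λ c → ∑ e λ d → ∑ c λ b → φ b c d e)
    ≡⟨ ∑-cong g (λ {e} _ → ∑-swap g e λ c d → ∑ c λ b → φ b c d e) ⟩
  ∑ g (λ e → ∑ e λ d → ∑ g λ c → ∑ c λ b → φ b c d e)
    ∎
  where open ≡-Reasoning

∑²-const : ∀ g k → ∑ g (λ c → ∑ c λ b → k) ≡ k * ∑ g (λ c → c)
∑²-const g k = trans (∑-cong g λ {c} _ → trans (∑-const c k) (*-comm c k)) (∑-*ˡ g k λ c → c)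

∑²-+ : ∀ g (φ ψ : ℕ → ℕ → ℕ) → ∑ g (λ c → ∑ c λ b → φ b c + ψ b c) ≡ ∑ g (λ c → ∑ c λ b → φ b c) + ∑ g (λ c → ∑ c λ b → ψ b c)
∑²-+ g φ ψ = trans (∑-cong g λ {c} _ → ∑-+ c (λ b → φ b c) (λ b → ψ b c)) (∑-+ g _ _)

-- Exchanging the two pairs shows that at most half of all pairs of pairs count.
smallerPairs-half : ∀ g → 8 * ∑ g (smallerPairs g) ≤ g * g * (g * g)
smallerPairs-half g = begin
  8 * s                          ≡⟨ *-assoc 4 2 s ⟩
  4 * (2 * s)                    ≡⟨ cong (λ x → 4 * (s + x)) (trans (+-identityʳ s) flip) ⟩
  4 * (s + s′)                   ≡⟨ cong (4 *_) merge ⟨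
  4 * both                       ≤⟨ *-monoʳ-≤ 4 both≤ ⟩
  4 * (p * p)                    ≡⟨ lemma p ⟩
  2 * p * (2 * p)                ≤⟨ *-mono-≤ (∑-triangle g) (∑-triangle g) ⟩
  g * g * (g * g)                ∎
  where
  open ≤-Reasoning
  lt gt : ℕ → ℕ → ℕ → ℕ → ℕ
  lt b c d e = ind (a b + a c <? a d + a e)
  gt b c d e = ind (a d + a e <? a b + a c)
  s = ∑ g (smallerPairs g)
  s′ = ∑ g λ c → ∑ c λ b → ∑ g λ e → ∑ e λ d → gt b c d e
  both = ∑ g λ c → ∑ c λ b → ∑ g λ e → ∑ e λ d → lt b c d e + gt b c d e
  p = ∑ g λ c → c
  lemma : ∀ p → 4 * (p * p) ≡ 2 * p * (2 * p)
  lemma = solve-∀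
  flip : s ≡ s′
  flip = ∑²-swap g lt
  merge : both ≡ s + s′
  merge = trans (∑-cong g λ {c} _ → ∑-cong c λ {b} _ → ∑²-+ g (λ d e → lt b c d e) (λ d e → gt b c d e))
    (∑²-+ g (λ b c → ∑ g λ e → ∑ e λ d → lt b c d e) (λ b c → ∑ g λ e → ∑ e λ d → gt b c d e))
  inner : ∀ b c → ∑ g (λ e → ∑ e λ d → lt b c d e + gt b c d e) ≤ p
  inner b c = begin
    ∑ g (λ e → ∑ e λ d → lt b c d e + gt b c d e)
      ≤⟨ ∑-mono g (λ {e} _ → ∑-mono e λ {d} _ → ind-asym (a b + a c <? a d + a e) (a d + a e <? a b + a c) <-asym) ⟩
    ∑ g (λ e → ∑ e λ d → 1)  ≡⟨ ∑²-const g 1 ⟩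
    1 * p                    ≡⟨ *-identityˡ p ⟩
    p                        ∎
  both≤ : both ≤ p * p
  both≤ = ≤-trans (∑-mono g λ {c} _ → ∑-mono c λ {b} _ → inner b c) (≤-reflexive (∑²-const g p))

∑³-below : ∀ g n → ∑ g (λ b → ∑ n λ e → ∑ e λ d → ind (b <? d)) ≤ ∑ n (λ e → ∑ e λ d → d)
∑³-below g n = begin
  ∑ g (λ b → ∑ n λ e → ∑ e λ d → ind (b <? d))  ≡⟨ ∑-swap g n (λ b e → ∑ e λ d → ind (b <? d)) ⟩
  ∑ n (λ e → ∑ g λ b → ∑ e λ d → ind (b <? d))  ≡⟨ ∑-cong n (λ {e} _ → ∑-swap g e λ b d → ind (b <? d)) ⟩
  ∑ n (λ e → ∑ e λ d → ∑ g λ b → ind (b <? d))  ≤⟨ ∑-mono n (λ {e} _ → ∑-mono e λ {d} _ → ∑-ind-< g d) ⟩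
  ∑ n (λ e → ∑ e λ d → d)                       ∎
  where open ≤-Reasoning

-- An overlap suc y + a b + a c ≡ a d + a e + a h is charged to g = max c h, for which a g ≤ y.
-- If c < h = g it forces a b + a c < a d + a e; if h ≤ c = g it forces b < d < e < h.
Hit : ℕ → ℕ → ℕ → ℕ → ℕ → ℕ → ℕ → Set
Hit g y c h b e d = a g ≤ y × suc y + (a b + a c) ≡ a d + a e + a h

hit? : ∀ g y c h b e d → Dec (Hit g y c h b e d)
hit? g y c h b e d = (a g ≤? y) ×-dec overlap? a (suc y) c h b e d

hits : ℕ → ℕ → ℕ → ℕ → ℕ
hits g y c h = ∑ c λ b → ∑ h λ e → ∑ e λ d → ind (hit? g y c h b e d)

overlaps≤hits : ∀ {g y} c h → a g ≤ y → overlapsAt a (suc y) c h ≤ hits g y c h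
overlaps≤hits {g} {y} c h ag≤y = ∑-mono c λ {b} _ → ∑-mono h λ {e} _ → ∑-mono e λ {d} _ →
  ind-mono (overlap? a (suc y) c h b e d) (hit? g y c h b e d) (ag≤y ,_)

-- With the sum over `y` moved innermost, the remaining indices determine `y`. Each index tuple thus
-- counts at most once, whatever `Y` is, and only if `Q` holds.
hits-charge : ∀ Y g c h {Q : ℕ → ℕ → ℕ → Set} (Q? : ∀ b d e → Dec (Q b d e)) →
  (∀ {y b e d} → e < h → d < e → Hit g y c h b e d → Q b d e) →
  ∑ Y (λ y → hits g y c h) ≤ ∑ c (λ b → ∑ h λ e → ∑ e λ d → ind (Q? b d e))
hits-charge Y g c h Q? Hit⇒Q = begin
  ∑ Y (λ y → hits g y c h)
    ≡⟨ ∑-swap Y c (λ y b → ∑ h λ e → ∑ e λ d → ind (hit? g y c h b e d)) ⟩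
  ∑ c (λ b → ∑ Y λ y → ∑ h λ e → ∑ e λ d → ind (hit? g y c h b e d))
    ≡⟨ ∑-cong c (λ {b} _ → ∑-swap Y h λ y e → ∑ e λ d → ind (hit? g y c h b e d)) ⟩
  ∑ c (λ b → ∑ h λ e → ∑ Y λ y → ∑ e λ d → ind (hit? g y c h b e d))
    ≡⟨ ∑-cong c (λ {b} _ → ∑-cong h λ {e} _ → ∑-swap Y e λ y d → ind (hit? g y c h b e d)) ⟩
  ∑ c (λ b → ∑ h λ e → ∑ e λ d → ∑ Y λ y → ind (hit? g y c h b e d))
    ≤⟨ ∑-mono c (λ {b} _ → ∑-mono h λ {e} e<h → ∑-mono e λ {d} d<e →
         ∑-charge Y (λ y → hit? g y c h b e d) (Q? b d e) (Hit⇒Q e<h d<e) (unique b e d)) ⟩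
  ∑ c (λ b → ∑ h λ e → ∑ e λ d → ind (Q? b d e))
    ∎
  where
  open ≤-Reasoning
  unique : ∀ b e d {y y′} → Hit g y c h b e d → Hit g y′ c h b e d → y ≡ y′
  unique b e d (_ , p) (_ , q) = suc-injective (+-cancelʳ-≡ (a b + a c) _ _ (trans p (sym q)))

hits-below : ∀ Y g c → ∑ Y (λ y → hits g y c g) ≤ smallerPairs g c
hits-below Y g c = hits-charge Y g c g (λ b d e → a b + a c <? a d + a e) below
  where
  below : ∀ {y b e d} → e < g → d < e → Hit g y c g b e d → a b + a c < a d + a e
  below {y} {b} {e} {d} _ _ (ag≤y , eq) = +-cancelˡ-< (a g) _ _ (begin-strict
    a g + (a b + a c)   <⟨ +-monoˡ-< (a b + a c) (s≤s ag≤y) ⟩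
    suc y + (a b + a c) ≡⟨ eq ⟩
    a d + a e + a g     ≡⟨ +-comm (a d + a e) (a g) ⟩
    a g + (a d + a e)   ∎)
    where open ≤-Reasoning

hits-top : ∀ Y g h → h ≤ g → ∑ Y (λ y → hits g y g h) ≤ ∑ g (λ b → ∑ h λ e → ∑ e λ d → ind (b <? d))
hits-top Y g h h≤g = hits-charge Y g g h (λ b d e → b <? d) below
  where
  below : ∀ {y b e d} → e < h → d < e → Hit g y g h b e d → b < d
  below {y} {b} {e} {d} e<h _ (ag≤y , eq) = a-cancel-< (+-cancelʳ-< (a e + a h) _ _ (begin-strict
    a b + (a e + a h)   ≤⟨ +-monoʳ-≤ (a b) (+-mono-≤ (a-mono-≤ (≤-trans (<⇒≤ e<h) h≤g)) (a-mono-≤ h≤g)) ⟩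
    a b + (a g + a g)   ≡⟨ lemma (a b) (a g) ⟩
    a g + (a b + a g)   <⟨ +-monoˡ-< (a b + a g) (s≤s ag≤y) ⟩
    suc y + (a b + a g) ≡⟨ eq ⟩
    a d + a e + a h     ≡⟨ +-assoc (a d) (a e) (a h) ⟩
    a d + (a e + a h)   ∎))
    where
    open ≤-Reasoning
    lemma : ∀ p q → p + (q + q) ≡ q + (p + q)
    lemma = solve-∀

hitsAll : ℕ → ℕ → ℕ
hitsAll g y = hits g y g g + ∑ g (λ c → hits g y c g) + ∑ g (λ h → hits g y g h)

-- The corner gives at most g³/6 hits (triples `b < d < e`), the column g⁴/8 (`smallerPairs-half`)
-- and the row g⁴/24 (quadruples `b < d < e < h`). Together 36 times this is 6g⁴ + 6g³, just below
-- the right-hand side.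
hitsAll-bound : ∀ Y g → 36 * ∑ Y (hitsAll g) ≤ 2 * (g * g) * width g
hitsAll-bound Y g = *-cancelˡ-≤ 2 (begin
  2 * (36 * ∑ Y (hitsAll g))     ≤⟨ *-monoʳ-≤ 2 (*-monoʳ-≤ 36 split) ⟩
  2 * (36 * (n₂ + n₁ + n₃))      ≡⟨ r₁ n₁ n₂ n₃ ⟩
  12 * (6 * n₂) + 9 * (8 * n₁) + 3 * (24 * n₃)
    ≤⟨ +-mono-≤ (+-mono-≤ (*-monoʳ-≤ 12 (∑-pairs g)) (*-monoʳ-≤ 9 (smallerPairs-half g))) (*-monoʳ-≤ 3 (∑-triples g)) ⟩
  12 * cube g + 9 * (g * g * (g * g)) + 3 * (g * g * (g * g))
    ≤⟨ ≤-by-slack (4 * (g * g)) (r₂ g) ⟩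
  2 * (2 * (g * g) * width g)    ∎)
  where
  open ≤-Reasoning
  n₁ = ∑ g (smallerPairs g)
  n₂ = ∑ g λ e → ∑ e λ d → d
  n₃ = ∑ g λ h → ∑ h λ e → ∑ e λ d → d
  r₁ : ∀ x y z → 2 * (36 * (y + x + z)) ≡ 12 * (6 * y) + 9 * (8 * x) + 3 * (24 * z)
  r₁ = solve-∀
  r₂ : ∀ g → 12 * (g * g * g) + 9 * (g * g * (g * g)) + 3 * (g * g * (g * g)) + 4 * (g * g) ≡ 2 * (2 * (g * g) * suc (3 * (g * g) + 3 * g))
  r₂ = solve-∀
  split : ∑ Y (hitsAll g) ≤ n₂ + n₁ + n₃
  split = begin
    ∑ Y (hitsAll g)
      ≡⟨ trans (∑-+ Y _ _) (cong (_+ ∑ Y (λ y → ∑ g λ h → hits g y g h)) (∑-+ Y _ _)) ⟩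
    ∑ Y (λ y → hits g y g g) + ∑ Y (λ y → ∑ g λ c → hits g y c g) + ∑ Y (λ y → ∑ g λ h → hits g y g h)
      ≡⟨ cong₂ (λ p q → ∑ Y (λ y → hits g y g g) + p + q) (∑-swap Y g λ y c → hits g y c g) (∑-swap Y g λ y h → hits g y g h) ⟩
    ∑ Y (λ y → hits g y g g) + ∑ g (λ c → ∑ Y λ y → hits g y c g) + ∑ g (λ h → ∑ Y λ y → hits g y g h)
      ≤⟨ +-mono-≤ (+-mono-≤ (≤-trans (hits-top Y g g ≤-refl) (∑³-below g g)) (∑-mono g λ {c} _ → hits-below Y g c))
           (∑-mono g λ {h} h<g → ≤-trans (hits-top Y g h (<⇒≤ h<g)) (∑³-below g h)) ⟩
    n₂ + n₁ + n₃
      ∎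

-- For `g < m` the term `a g` is at most m³, so every overlap in box `m` is a hit in some layer `g`.
-- The boxes then merge into one range of `y`, the same for all layers.
totalOverlaps≤hits : ∀ z → ∑ z (totalOverlaps a) ≤ ∑ z (λ g → ∑ (cube z) (hitsAll g))
totalOverlaps≤hits z = begin
  ∑ z (λ m → ∑ (width m) λ t → overlaps a m (point m t))
    ≤⟨ ∑-mono z (λ {m} m<z → ∑-mono (width m) λ {t} _ → early m<z t) ⟩
  ∑ z (λ m → ∑ (width m) λ t → ∑ z λ g → hitsAll g (cube m + t))
    ≡⟨ ∑-boxes z (λ y → ∑ z λ g → hitsAll g y) ⟩
  ∑ (cube z) (λ y → ∑ z λ g → hitsAll g y)
    ≡⟨ ∑-swap (cube z) z (λ y g → hitsAll g y) ⟩
  ∑ z (λ g → ∑ (cube z) λ y → hitsAll g y)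
    ∎
  where
  open ≤-Reasoning
  early : ∀ {m} → m < z → ∀ t → overlaps a m (point m t) ≤ ∑ z (λ g → hitsAll g (cube m + t))
  early {m} m<z t = begin
    overlaps a m (point m t)
      ≡⟨ ∑-square m (overlapsAt a (point m t)) ⟩
    ∑ m (λ g → overlapsAt a (point m t) g g + ∑ g (λ c → overlapsAt a (point m t) c g) + ∑ g (λ h → overlapsAt a (point m t) g h))
      ≤⟨ ∑-mono m (λ {g} g<m →
           let ag≤y = ≤-trans (proj₂ (a-inBox g)) (≤-trans (cube-mono-≤ g<m) (m≤m+n (cube m) t)) in
           +-mono-≤ (+-mono-≤ (overlaps≤hits g g ag≤y) (∑-mono g λ {c} _ → overlaps≤hits c g ag≤y))
             (∑-mono g λ {h} _ → overlaps≤hits g h ag≤y)) ⟩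
    ∑ m (λ g → hitsAll g (cube m + t))
      ≤⟨ ∑-extend (<⇒≤ m<z) (λ g → hitsAll g (cube m + t)) ⟩
    ∑ z (λ g → hitsAll g (cube m + t))
      ∎

-- Summation by parts: s need only be dominated by v * w in partial sums, since w increases.
∑-by-weights : ∀ {w u v s : ℕ → ℕ} → (∀ {m} → 0 < w m) → (∀ m → w m ≤ w (suc m)) →
  (∀ m → w m * u m ≤ s m) → (∀ z → ∑ z s ≤ ∑ z (λ m → v m * w m)) → ∀ z → ∑ z u ≤ ∑ z v
∑-by-weights {w} {u} {v} {s} 0<w w-mono wu≤s s≤vw z = cancel z (weighted z)
  where
  open ≤-Reasoning
  vw : ℕ → ℕ
  vw m = v m * w m
  cancel : ∀ {k} z → w k * ∑ z u + ∑ z vw ≤ w k * ∑ z v + ∑ z s → ∑ z u ≤ ∑ z v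
  cancel {k} z ineq = *-cancelˡ-≤ (w k) {{>-nonZero 0<w}}
    (+-cancelʳ-≤ (∑ z vw) _ _ (≤-trans ineq (+-monoʳ-≤ (w k * ∑ z v) (s≤vw z))))
  raise : ∀ {p q x y i j} → p ≤ q → i ≤ j → p * i + x ≤ p * j + y → q * i + x ≤ q * j + y
  raise {p} {x = x} {y} {i} {j} p≤q i≤j ineq with m≤n⇒∃[o]m+o≡n p≤q
  ... | o , refl = begin
    (p + o) * i + x    ≡⟨ r p o i x ⟩
    p * i + x + o * i  ≤⟨ +-mono-≤ ineq (*-monoʳ-≤ o i≤j) ⟩
    p * j + y + o * j  ≡⟨ r p o j y ⟨
    (p + o) * j + y    ∎
    where
    r : ∀ p o i x → (p + o) * i + x ≡ p * i + x + o * i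
    r = solve-∀
  -- With U, V, S, T the partial sums of `u`, `v`, `s`, `vw`, the invariant is w(U - V) ≤ S - T,
  -- written without subtraction. It survives a larger weight because U ≤ V.
  weighted : ∀ z → w z * ∑ z u + ∑ z vw ≤ w z * ∑ z v + ∑ z s
  weighted zero    = ≤-refl
  weighted (suc z) = raise (w-mono z) (cancel (suc z) next) next
    where
    r₁ : ∀ w u v x y → w * (u + x) + (v * w + y) ≡ w * u + w * v + (w * x + y)
    r₁ = solve-∀
    r₂ : ∀ w s v x y → s + w * v + (w * x + y) ≡ w * (v + x) + (s + y)
    r₂ = solve-∀
    next : w z * ∑ (suc z) u + ∑ (suc z) vw ≤ w z * ∑ (suc z) v + ∑ (suc z) s
    next = begin
      w z * (u z + ∑ z u) + (v z * w z + ∑ z vw)      ≡⟨ r₁ (w z) (u z) (v z) (∑ z u) (∑ z vw) ⟩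
      w z * u z + w z * v z + (w z * ∑ z u + ∑ z vw)  ≤⟨ +-mono-≤ (+-monoˡ-≤ (w z * v z) (wu≤s z)) (weighted z) ⟩
      s z + w z * v z + (w z * ∑ z v + ∑ z s)         ≡⟨ r₂ (w z) (s z) (v z) (∑ z v) (∑ z s) ⟩
      w z * (v z + ∑ z v) + (s z + ∑ z s)             ∎

-- Hits are bounded only in total over all boxes up to `z`, so the widths are divided out by
-- `∑-by-weights`. What remains is g²/9 per index, and the squares sum to at most z³/3.
∑-overlaps : ∀ z → 27 * ∑ z (λ m → overlaps a m (a m)) ≤ cube z
∑-overlaps z = *-cancelˡ-≤ 2 (begin
  2 * (27 * ov z)        ≡⟨ r₀ (ov z) ⟩
  3 * (18 * ov z)        ≡⟨ cong (3 *_) (∑-*ˡ z 18 _) ⟨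
  3 * ∑ z (λ m → 18 * overlaps a m (a m)) ≤⟨ *-monoʳ-≤ 3 bound ⟩
  3 * ∑ z (λ g → 2 * (g * g)) ≡⟨ cong (3 *_) (∑-*ˡ z 2 λ g → g * g) ⟩
  3 * (2 * ∑ z (λ g → g * g)) ≡⟨ r (∑ z λ g → g * g) ⟩
  2 * (3 * ∑ z (λ g → g * g)) ≤⟨ *-monoʳ-≤ 2 (∑-squares z) ⟩
  2 * cube z ∎)
  where
  open ≤-Reasoning
  ov : ℕ → ℕ
  ov z = ∑ z λ m → overlaps a m (a m)
  r₀ : ∀ s → 2 * (27 * s) ≡ 3 * (18 * s)
  r₀ = solve-∀
  r : ∀ s → 3 * (2 * s) ≡ 2 * (3 * s)
  r = solve-∀
  r₁ : ∀ w v → w * (18 * v) ≡ 18 * (w * v)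
  r₁ = solve-∀
  r₂ : ∀ o → 18 * (2 * o) ≡ 36 * o
  r₂ = solve-∀
  bound : ∑ z (λ m → 18 * overlaps a m (a m)) ≤ ∑ z (λ g → 2 * (g * g))
  bound = ∑-by-weights {w = width} {s = λ m → 36 * totalOverlaps a m} (s≤s z≤n) (λ m → width-mono (n≤1+n m))
    (λ m → begin
      width m * (18 * overlaps a m (a m))  ≡⟨ r₁ (width m) (overlaps a m (a m)) ⟩
      18 * (width m * overlaps a m (a m))  ≤⟨ *-monoʳ-≤ 18 (a-fewOverlaps m) ⟩
      18 * (2 * totalOverlaps a m)         ≡⟨ r₂ (totalOverlaps a m) ⟩
      36 * totalOverlaps a m               ∎)
    (λ z → begin
      ∑ z (λ m → 36 * totalOverlaps a m)                ≡⟨ ∑-*ˡ z 36 (totalOverlaps a) ⟩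
      36 * ∑ z (totalOverlaps a)                        ≤⟨ *-monoʳ-≤ 36 (totalOverlaps≤hits z) ⟩
      36 * ∑ z (λ g → ∑ (cube z) (hitsAll g))           ≤⟨ ∑-scale-mono z 36 (hitsAll-bound (cube z)) ⟩
      ∑ z (λ g → 2 * (g * g) * width g)                 ∎)
    z

-- The Sidon set and its threefold sumset.

A : Pred ℕ 0ℓ
A x = ∃[ m ] a m ≡ x

i<ai : ∀ i → i < a i
i<ai i = ≤-<-trans (i≤i³ i) (proj₁ (a-inBox i))
  where
  i≤i³ : ∀ i → i ≤ cube i
  i≤i³ zero    = z≤n
  i≤i³ (suc i) = ≤-trans (m≤m*n (suc i) (suc i)) (m≤m*n (suc i * suc i) (suc i))

A-positive : IsPositiveSet A
A-positive (m , refl) = ≤-<-trans z≤n (i<ai m)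

A-sidon : IsSidon A
A-sidon n _ (i , refl) (j , refl) ai≤aj p (k , refl) (l , refl) ak≤al q =
  let i≡k , j≡l = a-sidon (a-cancel-≤ ai≤aj) (a-cancel-≤ ak≤al) (trans p (sym q))
  in cong a i≡k , cong a j≡l

-- Since `i < a i`, all indices in a representation of `n` are below `n`, and a finite search
-- decides.
sumset? : Decidable (ThreefoldSumset A)
sumset? n = map′
  (λ { (i , _ , j , _ , k , _ , eq) → a i , a j , a k , (i , refl) , (j , refl) , (k , refl) , eq })
  (λ { (_ , _ , _ , (i , refl) , (j , refl) , (k , refl) , eq) →
    i , below i (≤-trans (m≤m+n (a i) (a j)) (m≤m+n (a i + a j) (a k))) eq ,
    j , below j (≤-trans (m≤n+m (a j) (a i)) (m≤m+n (a i + a j) (a k))) eq ,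
    k , below k (m≤n+m (a k) (a i + a j)) eq , eq })
  (anyUpTo? (λ i → anyUpTo? (λ j → anyUpTo? (λ k → n ≟ a i + a j + a k) n) n) n)
  where
  below : ∀ i {s} → a i ≤ s → n ≡ s → i < n
  below i ai≤s refl = <-≤-trans (i<ai i) ai≤s

count-∑ : {X : Pred ℕ 0ℓ} (X? : Decidable X) → ∀ n → count X? n ≡ ∑ n (λ v → ind (X? (suc v)))
count-∑ X? zero    = refl
count-∑ X? (suc n) = begin
  length (filter X? (map suc (upTo (suc n))))
    ≡⟨ cong (λ vs → length (filter X? (map suc vs))) (upTo-∷ʳ n) ⟨
  length (filter X? (map suc (upTo n ∷ʳ n)))
    ≡⟨ cong (length ∘ filter X?) (map-++ suc (upTo n) (n ∷ [])) ⟩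
  length (filter X? (map suc (upTo n) ∷ʳ suc n))
    ≡⟨ cong length (filter-++ X? (map suc (upTo n)) (suc n ∷ [])) ⟩
  length (filter X? (map suc (upTo n)) List.++ filter X? (suc n ∷ []))
    ≡⟨ length-++ (filter X? (map suc (upTo n))) ⟩
  count X? n + length (filter X? (suc n ∷ []))
    ≡⟨ cong₂ _+_ (count-∑ X? n) last ⟩
  ∑ n (λ v → ind (X? (suc v))) + ind (X? (suc n))
    ≡⟨ +-comm _ (ind (X? (suc n))) ⟩
  ∑ (suc n) (λ v → ind (X? (suc v)))
    ∎
  where
  open ≡-Reasoning
  last : length (filter X? (suc n ∷ [])) ≡ ind (X? (suc n))
  last with does (X? (suc n))
  ... | true  = refl
  ... | false = refl

-- Representations and collisions.

sum? : ∀ m c b v → Dec (a m + (a b + a c) ≡ suc v)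
sum? m c b v = a m + (a b + a c) ≟ suc v

-- Representations `b < c < m` of `suc v` with top index `m`; the shift matches `count`, which
-- starts at 1.
reps : ℕ → ℕ → ℕ
reps m v = ∑ m λ c → ∑ c λ b → ind (sum? m c b v)

repsBelow : ℕ → ℕ → ℕ
repsBelow z v = ∑ z λ m → reps m v

-- Once the top term is fixed, the Sidon property determines the other two.
reps≤1 : ∀ m v → reps m v ≤ 1
reps≤1 m v = ∑-unique m
  (λ {c} _ → ∑-unique c (λ {b} _ → ind≤1 (sum? m c b v))
    λ {b} {b′} b<c b′<c p q → proj₁ (same b<c b′<c (ind-sound (sum? m c b v) p) (ind-sound (sum? m c b′ v) q)))
  λ {c} {c′} _ _ p q →
    let b  , b<c   , h  = ∑-positive c p
        b′ , b′<c′ , h′ = ∑-positive c′ q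
    in proj₂ (same b<c b′<c′ (ind-sound (sum? m c b v) h) (ind-sound (sum? m c′ b′ v) h′))
  where
  same : ∀ {b c b′ c′} → b < c → b′ < c′ → a m + (a b + a c) ≡ suc v → a m + (a b′ + a c′) ≡ suc v → b ≡ b′ × c ≡ c′
  same b<c b′<c′ p q = a-sidon (<⇒≤ b<c) (<⇒≤ b′<c′) (+-cancelˡ-≡ (a m) _ _ (trans p (sym q)))

reps⇒sumset : ∀ m v → 1 ≤ reps m v → ThreefoldSumset A (suc v)
reps⇒sumset m v 1≤reps with ∑-positive m 1≤reps
... | c , _ , 1≤reps′ with ∑-positive c 1≤reps′
...   | b , _ , hit = a m , a b , a c , (m , refl) , (b , refl) , (c , refl) ,
  trans (sym (ind-sound (sum? m c b v) hit)) (sym (+-assoc (a m) (a b) (a c)))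

-- The first representation of suc v makes it a member of the sumset,
-- and each later one collides with all its predecessors.
repsBelow-bound : ∀ v z → repsBelow z v ≤ ind (sumset? (suc v)) + ∑ z (λ m → reps m v * repsBelow m v)
repsBelow-bound v zero = z≤n
repsBelow-bound v (suc z) with repsBelow z v in eq
... | zero = begin
  reps z v + 0                ≡⟨ +-identityʳ (reps z v) ⟩
  reps z v                    ≤⟨ member ⟩
  ind (sumset? (suc v))       ≤⟨ m≤m+n _ _ ⟩
  ind (sumset? (suc v)) + (reps z v * 0 + ∑ z (λ m → reps m v * repsBelow m v)) ∎
  where
  open ≤-Reasoning
  member : reps z v ≤ ind (sumset? (suc v))
  member with reps z v in eq′
  ... | zero  = z≤n
  ... | suc r = ≤-trans (subst (_≤ 1) eq′ (reps≤1 z v))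
    (ind-complete (sumset? (suc v)) (reps⇒sumset z v (≤-trans (s≤s z≤n) (≤-reflexive (sym eq′)))))
... | suc r = begin
  reps z v + suc r ≤⟨ +-mono-≤ (m≤m*n (reps z v) (suc r)) (subst (_≤ i + s) eq (repsBelow-bound v z)) ⟩
  reps z v * suc r + (i + s)   ≡⟨ lemma (reps z v * suc r) i s ⟩
  i + (reps z v * suc r + s)   ∎
  where
  open ≤-Reasoning
  i = ind (sumset? (suc v))
  s = ∑ z λ m → reps m v * repsBelow m v
  lemma : ∀ x y z → x + (y + z) ≡ y + (x + z)
  lemma = solve-∀

∑-product : ∀ m n f g → ∑ m f * ∑ n g ≡ ∑ m (λ i → ∑ n (λ j → f i * g j))
∑-product zero    n f g = refl
∑-product (suc m) n f g = trans (*-distribʳ-+ (∑ n g) (f m) (∑ m f))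
  (cong₂ _+_ (sym (∑-*ˡ n (f m) g)) (∑-product m n f g))

∑-charge₂ : ∀ n {P Q : ℕ → Set} {R : Set} (P? : ∀ i → Dec (P i)) (Q? : ∀ i → Dec (Q i)) (R? : Dec R) →
  (∀ {i} → P i → Q i → R) → (∀ {i j} → P i → P j → i ≡ j) → ∑ n (λ i → ind (P? i) * ind (Q? i)) ≤ ind R?
∑-charge₂ n P? Q? R? PQ⇒R unique = ≤-trans (∑-mono n λ {i} _ → merge (P? i) (Q? i))
  (∑-charge n (λ i → P? i ×-dec Q? i) R? (λ (p , q) → PQ⇒R p q) λ (p , _) (p′ , _) → unique p p′)
  where
  merge : ∀ {P Q : Set} (P? : Dec P) (Q? : Dec Q) → ind P? * ind Q? ≤ ind (P? ×-dec Q?)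
  merge (yes _) (yes _) = ≤-refl
  merge (yes _) (no _)  = z≤n
  merge (no _)  _       = z≤n

-- Two representations of one number, with top indices `m` and `h < m`, form an overlap of `a m`.
-- The sum over `v` collapses because a representation determines `v`.
collisions≤overlaps : ∀ n m → ∑ n (λ v → reps m v * repsBelow m v) ≤ overlaps a m (a m)
collisions≤overlaps n m = begin
  ∑ n (λ v → reps m v * repsBelow m v)
    ≡⟨ ∑-cong n (λ {v} _ → trans (∑-product m m _ _) (∑-cong m λ {c} _ → ∑-cong m λ {h} _ →
         trans (∑-product c h _ _) (∑-cong c λ {b} _ → ∑-cong h λ {e} _ → sym (∑-*ˡ e (ind (sum? m c b v)) _)))) ⟩
  ∑ n (λ v → ∑ m λ c → ∑ m λ h → ∑ c λ b → ∑ h λ e → ∑ e λ d → both c h b e d v)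
    ≡⟨ ∑-swap n m (λ v c → ∑ m λ h → ∑ c λ b → ∑ h λ e → ∑ e λ d → both c h b e d v) ⟩
  ∑ m (λ c → ∑ n λ v → ∑ m λ h → ∑ c λ b → ∑ h λ e → ∑ e λ d → both c h b e d v)
    ≡⟨ ∑-cong m (λ {c} _ → ∑-swap n m λ v h → ∑ c λ b → ∑ h λ e → ∑ e λ d → both c h b e d v) ⟩
  ∑ m (λ c → ∑ m λ h → ∑ n λ v → ∑ c λ b → ∑ h λ e → ∑ e λ d → both c h b e d v)
    ≡⟨ ∑-cong m (λ {c} _ → ∑-cong m λ {h} _ → ∑-swap n c λ v b → ∑ h λ e → ∑ e λ d → both c h b e d v) ⟩
  ∑ m (λ c → ∑ m λ h → ∑ c λ b → ∑ n λ v → ∑ h λ e → ∑ e λ d → both c h b e d v)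
    ≡⟨ ∑-cong m (λ {c} _ → ∑-cong m λ {h} _ → ∑-cong c λ {b} _ → ∑-swap n h λ v e → ∑ e λ d → both c h b e d v) ⟩
  ∑ m (λ c → ∑ m λ h → ∑ c λ b → ∑ h λ e → ∑ n λ v → ∑ e λ d → both c h b e d v)
    ≡⟨ ∑-cong m (λ {c} _ → ∑-cong m λ {h} _ → ∑-cong c λ {b} _ → ∑-cong h λ {e} _ → ∑-swap n e λ v d → both c h b e d v) ⟩
  ∑ m (λ c → ∑ m λ h → ∑ c λ b → ∑ h λ e → ∑ e λ d → ∑ n λ v → both c h b e d v)
    ≤⟨ ∑-mono m (λ {c} _ → ∑-mono m λ {h} _ → ∑-mono c λ {b} _ → ∑-mono h λ {e} _ → ∑-mono e λ {d} _ →
         ∑-charge₂ n (sum? m c b) (sum? h e d) (overlap? a (a m) c h b e d)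
           (λ p q → trans p (trans (sym q) (+-comm (a h) (a d + a e))))
           (λ p q → suc-injective (trans (sym p) q))) ⟩
  overlaps a m (a m)
    ∎
  where
  open ≤-Reasoning
  both : ℕ → ℕ → ℕ → ℕ → ℕ → ℕ → ℕ
  both c h b e d v = ind (sum? m c b v) * ind (sum? h e d v)

-- Triples with small sum.

small? : ∀ n m c b → Dec (a m + (a b + a c) ≤ n)
small? n m c b = a m + (a b + a c) ≤? n

smallTriples : ℕ → ℕ → ℕ
smallTriples z n = ∑ z λ m → ∑ m λ c → ∑ c λ b → ind (small? n m c b)

small-hit : ∀ n m c b → ind (small? n m c b) ≤ ∑ n (λ v → ind (sum? m c b v))
small-hit n m c b = ind-bound (small? n m c b) λ ≤n → found ≤n refl
  where
  found : ∀ {s} → s ≤ n → a m + (a b + a c) ≡ s → 1 ≤ ∑ n (λ v → ind (sum? m c b v))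
  found {zero}  _   eq = contradiction (subst (m <_) eq (≤-trans (i<ai m) (m≤m+n (a m) _))) λ ()
  found {suc s} s<n eq = ≤-trans (ind-complete (sum? m c b s) eq) (term≤∑ s<n λ v → ind (sum? m c b v))

smallTriples≤reps : ∀ z n → smallTriples z n ≤ ∑ n (repsBelow z)
smallTriples≤reps z n = begin
  ∑ z (λ m → ∑ m λ c → ∑ c λ b → ind (small? n m c b))
    ≤⟨ ∑-mono z (λ {m} _ → ∑-mono m λ {c} _ → ∑-mono c λ {b} _ → small-hit n m c b) ⟩
  ∑ z (λ m → ∑ m λ c → ∑ c λ b → ∑ n λ v → ind (sum? m c b v))
    ≡⟨ ∑-cong z (λ {m} _ → ∑-cong m λ {c} _ → ∑-swap c n λ b v → ind (sum? m c b v)) ⟩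
  ∑ z (λ m → ∑ m λ c → ∑ n λ v → ∑ c λ b → ind (sum? m c b v))
    ≡⟨ ∑-cong z (λ {m} _ → ∑-swap m n λ c v → ∑ c λ b → ind (sum? m c b v)) ⟩
  ∑ z (λ m → ∑ n λ v → reps m v)
    ≡⟨ ∑-swap z n (λ m v → reps m v) ⟩
  ∑ n (repsBelow z)
    ∎
  where open ≤-Reasoning

-- Small triples are representations of numbers up to `n`; by `repsBelow-bound` they outnumber the
-- represented values by at most the collisions.
smallTriples≤count : ∀ z n → smallTriples z n ≤ count sumset? n + ∑ z (λ m → overlaps a m (a m))
smallTriples≤count z n = begin
  smallTriples z n
    ≤⟨ smallTriples≤reps z n ⟩
  ∑ n (repsBelow z)
    ≤⟨ ∑-mono n (λ {v} _ → repsBelow-bound v z) ⟩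
  ∑ n (λ v → ind (sumset? (suc v)) + ∑ z (λ m → reps m v * repsBelow m v))
    ≡⟨ ∑-+ n (λ v → ind (sumset? (suc v))) (λ v → ∑ z λ m → reps m v * repsBelow m v) ⟩
  ∑ n (λ v → ind (sumset? (suc v))) + ∑ n (λ v → ∑ z λ m → reps m v * repsBelow m v)
    ≡⟨ cong₂ _+_ (sym (count-∑ sumset? n)) (∑-swap n z λ v m → reps m v * repsBelow m v) ⟩
  count sumset? n + ∑ z (λ m → ∑ n λ v → reps m v * repsBelow m v)
    ≤⟨ +-monoʳ-≤ (count sumset? n) (∑-mono z λ {m} _ → collisions≤overlaps n m) ⟩
  count sumset? n + ∑ z (λ m → overlaps a m (a m))
    ∎
  where open ≤-Reasoning

-- A lower Riemann sum for the number of small triples.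

-- The test is made at the far corner of the unit cell, so that it covers every point of the cell.
cell? : ∀ q w v u → Dec (cube (suc w) + (cube (suc u) + cube (suc v)) ≤ cube q)
cell? q w v u = cube (suc w) + (cube (suc u) + cube (suc v)) ≤? cube q

cells : ℕ → ℕ
cells q = ∑ q λ w → ∑ w λ v → ∑ v λ u → ind (cell? q w v u)

∑-blocks : ∀ q M {k f} → (∀ {w r} → w < q → r < M → k w ≤ f (w * M + r)) → M * ∑ q k ≤ ∑ (q * M) f
∑-blocks zero    M k≤f = ≤-reflexive (*-zeroʳ M)
∑-blocks (suc q) M {k} {f} k≤f = begin
  M * (k q + ∑ q k)                              ≡⟨ *-distribˡ-+ M (k q) (∑ q k) ⟩
  M * k q + M * ∑ q k                            ≤⟨ +-mono-≤ (∑-const-≥ M (k≤f ≤-refl)) (∑-blocks q M (k≤f ∘ m<n⇒m<1+n)) ⟩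
  ∑ M (λ r → f (q * M + r)) + ∑ (q * M) f        ≡⟨ +-comm _ (∑ (q * M) f) ⟩
  ∑ (q * M) f + ∑ M (λ r → f (q * M + r))        ≡⟨ ∑-split (q * M) M f ⟨
  ∑ (q * M + M) f                                ≡⟨ cong (λ n → ∑ n f) (+-comm (q * M) M) ⟩
  ∑ (suc q * M) f                                ∎
  where open ≤-Reasoning

-- Scaled by `M`, a cell holds M³ index triples, ordered because `u < v < w` are distinct blocks.
-- `∑-extend` drops triples with two indices in one block.
smallTriples-cells : ∀ q M n → cube (q * M) ≤ n → cube M * cells q ≤ smallTriples (q * M) n
smallTriples-cells q M n qM³≤n = begin
  cube M * cells q            ≡⟨ trans (*-assoc (M * M) M _) (*-assoc M M _) ⟩
  M * (M * (M * cells q))     ≡⟨ cong (λ s → M * (M * s)) (∑-*ˡ q M _) ⟨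
  M * (M * ∑ q (λ w → M * ∑ w λ v → ∑ v λ u → ind (cell? q w v u)))
    ≡⟨ cong (M *_) (∑-*ˡ q M _) ⟨
  M * ∑ q (λ w → M * (M * ∑ w λ v → ∑ v λ u → ind (cell? q w v u)))
    ≡⟨ cong (M *_) (∑-cong q λ {w} _ → cong (M *_) (∑-*ˡ w M _)) ⟨
  M * ∑ q (λ w → M * ∑ w λ v → M * ∑ v λ u → ind (cell? q w v u))
    ≤⟨ ∑-blocks q M (λ {w} {r} _ r<M → ≤-trans
         (∑-blocks w M λ {v} {s} _ s<M → ≤-trans
           (∑-blocks v M λ {u} {t} _ t<M → ind-mono (cell? q w v u) (small? n _ _ _) (fits w v u r<M s<M t<M))
           (∑-extend (m≤m+n (v * M) s) _))
         (∑-extend (m≤m+n (w * M) r) _)) ⟩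
  smallTriples (q * M) n      ∎
  where
  open ≤-Reasoning
  top : ∀ w {r} → r < M → a (w * M + r) ≤ cube (suc w) * cube M
  top w {r} r<M = begin
    a (w * M + r)            ≤⟨ proj₂ (a-inBox (w * M + r)) ⟩
    cube (suc (w * M + r))   ≤⟨ cube-mono-≤ (begin
      suc (w * M + r)  ≡⟨ +-suc (w * M) r ⟨
      w * M + suc r    ≤⟨ +-monoʳ-≤ (w * M) r<M ⟩
      w * M + M        ≡⟨ +-comm (w * M) M ⟩
      suc w * M        ∎) ⟩
    cube (suc w * M)         ≡⟨ cube-* (suc w) M ⟩
    cube (suc w) * cube M    ∎
  distrib : ∀ x y z k → x * k + (y * k + z * k) ≡ (x + (y + z)) * k
  distrib = solve-∀
  fits : ∀ w v u {r s t} → r < M → s < M → t < M → cube (suc w) + (cube (suc u) + cube (suc v)) ≤ cube q →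
    a (w * M + r) + (a (u * M + t) + a (v * M + s)) ≤ n
  fits w v u {r} {s} {t} r<M s<M t<M ≤q³ = begin
    a (w * M + r) + (a (u * M + t) + a (v * M + s))
      ≤⟨ +-mono-≤ (top w r<M) (+-mono-≤ (top u t<M) (top v s<M)) ⟩
    cube (suc w) * cube M + (cube (suc u) * cube M + cube (suc v) * cube M)
      ≡⟨ distrib (cube (suc w)) (cube (suc u)) (cube (suc v)) (cube M) ⟩
    (cube (suc w) + (cube (suc u) + cube (suc v))) * cube M
      ≤⟨ *-monoˡ-≤ (cube M) ≤q³ ⟩
    cube q * cube M
      ≡⟨ cube-* q M ⟨
    cube (q * M)
      ≤⟨ qM³≤n ⟩
    n
      ∎

-- From the cell count to the density.

count-lower : ∀ q M n → cube (q * M) ≤ n → 27 * (cube M * cells q) ≤ 27 * count sumset? n + cube q * cube M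
count-lower q M n qM³≤n = begin
  27 * (cube M * cells q)                    ≤⟨ *-monoʳ-≤ 27 (smallTriples-cells q M n qM³≤n) ⟩
  27 * smallTriples (q * M) n                ≤⟨ *-monoʳ-≤ 27 (smallTriples≤count (q * M) n) ⟩
  27 * (count sumset? n + v)                 ≡⟨ *-distribˡ-+ 27 (count sumset? n) v ⟩
  27 * count sumset? n + 27 * v              ≤⟨ +-monoʳ-≤ (27 * count sumset? n) (∑-overlaps (q * M)) ⟩
  27 * count sumset? n + cube (q * M)        ≡⟨ cong (λ s → 27 * count sumset? n + s) (cube-* q M) ⟩
  27 * count sumset? n + cube q * cube M     ∎
  where
  open ≤-Reasoning
  v = ∑ (q * M) λ m → overlaps a m (a m)

abstract
  -- Checked by evaluating all 19600 cells.
  cells-50 : cells 50 ≡ 13434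
  cells-50 = refl

-- Found by counting up to `n`: when `suc n` reaches the next bound it equals it, so `M` grows by
-- exactly one.
cube-floor : ∀ q → 0 < q → ∀ n → ∃[ M ] cube (q * M) ≤ n × n < cube (q * suc M)
cube-floor q 0<q zero = 0 , ≤-reflexive (cong cube (*-zeroʳ q)) ,
  subst (λ x → 0 < cube x) (sym (*-identityʳ q)) (cube-mono-≤ {1} 0<q)
cube-floor q 0<q (suc n) with cube-floor q 0<q n
... | M , lower , upper with suc n <? cube (q * suc M)
...   | yes upper′ = M , m≤n⇒m≤1+n lower , upper′
...   | no ≮       = suc M , ≮⇒≥ ≮ , ≤-<-trans upper (cube-mono-< (*-monoʳ-< q {{>-nonZero 0<q}} ≤-refl))
  where
  cube-mono-< : ∀ {m n} → m < n → cube m < cube n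
  cube-mono-< m<n = *-mono-< (*-mono-< m<n m<n) m<n

-- Multiplies n/y ≤ ζ, y/x ≤ α/β and x/c ≤ δ/γ in cross-multiplied form; `num` compares the product
-- of the bounds with σ/ρ.
scale-chain : ∀ {α β γ δ ζ ρ σ n c x y} → 0 < β * δ →
  n ≤ ζ * y → β * y ≤ α * x → γ * x ≤ δ * c → ρ * δ * ζ * α ≤ σ * β * γ → ρ * n ≤ σ * c
scale-chain {α} {β} {γ} {δ} {ζ} {ρ} {σ} {n} {c} {x} {y} 0<βδ n≤ζy βy≤αx γx≤δc num =
  *-cancelˡ-≤ (β * δ) {{>-nonZero 0<βδ}} (begin
    β * δ * (ρ * n)           ≤⟨ *-monoʳ-≤ (β * δ) (*-monoʳ-≤ ρ n≤ζy) ⟩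
    β * δ * (ρ * (ζ * y))     ≡⟨ r₁ β δ ρ ζ y ⟩
    ρ * δ * ζ * (β * y)       ≤⟨ *-monoʳ-≤ (ρ * δ * ζ) βy≤αx ⟩
    ρ * δ * ζ * (α * x)       ≡⟨ *-assoc (ρ * δ * ζ) α x ⟨
    ρ * δ * ζ * α * x         ≤⟨ *-monoˡ-≤ x num ⟩
    σ * β * γ * x             ≡⟨ *-assoc (σ * β) γ x ⟩
    σ * β * (γ * x)           ≤⟨ *-monoʳ-≤ (σ * β) γx≤δc ⟩
    σ * β * (δ * c)           ≡⟨ r₂ σ β δ c ⟩
    β * δ * (σ * c)           ∎)
  where
  open ≤-Reasoning
  r₁ : ∀ β δ ρ ζ y → β * δ * (ρ * (ζ * y)) ≡ ρ * δ * ζ * (β * y)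
  r₁ = solve-∀
  r₂ : ∀ σ β δ c → σ * β * (δ * c) ≡ β * δ * (σ * c)
  r₂ = solve-∀

-- The ratio (M+1)/M decreases as `M` grows.
cube-ratio : ∀ p {M} → p ≤ M → cube p * cube (suc M) ≤ cube (suc p) * cube M
cube-ratio p {M} p≤M = begin
  cube p * cube (suc M)  ≡⟨ cube-* p (suc M) ⟨
  cube (p * suc M)       ≤⟨ cube-mono-≤ (begin
    p * suc M  ≡⟨ *-suc p M ⟩
    p + p * M  ≤⟨ +-monoˡ-≤ (p * M) p≤M ⟩
    suc p * M  ∎) ⟩
  cube (suc p * M)       ≡⟨ cube-* (suc p) M ⟩
  cube (suc p) * cube M  ∎
  where open ≤-Reasoning

-- The equation for `κ` stands in for a truncated subtraction.
count-cells : ∀ q M n {κ} → cube (q * M) ≤ n → 27 * cells q ≡ cube q + κ → κ * cube M ≤ 27 * count sumset? n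
count-cells q M n {κ} qM³≤n eq = +-cancelʳ-≤ (cube q * cube M) _ _ (begin
  κ * cube M + cube q * cube M    ≡⟨ *-distribʳ-+ (cube M) κ (cube q) ⟨
  (κ + cube q) * cube M           ≡⟨ cong (_* cube M) (trans (+-comm κ (cube q)) (sym eq)) ⟩
  27 * cells q * cube M           ≡⟨ *-assoc 27 (cells q) (cube M) ⟩
  27 * (cells q * cube M)         ≡⟨ cong (27 *_) (*-comm (cells q) (cube M)) ⟩
  27 * (cube M * cells q)         ≤⟨ count-lower q M n qM³≤n ⟩
  27 * count sumset? n + cube q * cube M ∎)
  where open ≤-Reasoning

-- The ratio is at least (cells q / q³ - 1/27) * (p / suc p)³ once n ≥ (q * p)³.
count-ratio : ∀ q p {κ ρ σ n} → 0 < q → 0 < p → cube (q * p) ≤ n → 27 * cells q ≡ cube q + κ →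
  ρ * 27 * cube q * cube (suc p) ≤ σ * cube p * κ → ρ * n ≤ σ * count sumset? n
count-ratio q p {κ} {ρ} {σ} {n} 0<q 0<p qp³≤n eq num with cube-floor q 0<q n
... | M , lower , upper = scale-chain {α = cube (suc p)} {cube p} {κ} {27} {ζ = cube q} {ρ} {σ} {x = cube M} {cube (suc M)}
  (*-mono-< {0} {cube p} {0} {27} (cube-mono-≤ {1} 0<p) (s≤s z≤n))
  (≤-trans (<⇒≤ upper) (≤-reflexive (cube-* q (suc M))))
  (cube-ratio p p≤M)
  (count-cells q M n lower eq)
  num
  where
  p≤M : p ≤ M
  p≤M = s≤s⁻¹ (*-cancelˡ-< q p (suc M) (cube-cancel-< (≤-<-trans qp³≤n upper)))

-- As `/` reduces to lowest terms, the comparison is made on unnormalised fractions.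
/-mono-≤ : ∀ p d q e → p * suc e ≤ suc d * q → + p / suc d ℚ.≤ + q / suc e
/-mono-≤ p d q e pe≤dq = ℚ.toℚᵘ-cancel-≤ (begin
  ℚ.toℚᵘ (+ p / suc d)  ≃⟨ ℚ.toℚᵘ-fromℚᵘ (ℚᵘ.mkℚᵘ (+ p) d) ⟩
  ℚᵘ.mkℚᵘ (+ p) d       ≤⟨ ℚᵘ.*≤* (subst₂ ℤ._≤_ (ℤ.pos-* p (suc e)) (ℤ.pos-* q (suc d)) (ℤ.+≤+ pe≤qd)) ⟩
  ℚᵘ.mkℚᵘ (+ q) e       ≃⟨ ℚ.toℚᵘ-fromℚᵘ (ℚᵘ.mkℚᵘ (+ q) e) ⟨
  ℚ.toℚᵘ (+ q / suc e)  ∎)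
  where
  open ℚᵘ.≤-Reasoning
  pe≤qd : p * suc e ≤ q * suc d
  pe≤qd = ≤-trans pe≤dq (≤-reflexive (*-comm (suc d) q))

-- 237718 = 27 * 13434 - 50³
sumset-dense : ∀ n → cube (50 * 40) ≤ n → 13 * n ≤ 200 * count sumset? n
sumset-dense n N≤n = count-ratio 50 40 {237718} {13} {200} {n} (s≤s z≤n) (s≤s z≤n) N≤n (cong (27 *_) cells-50)
  -- In decimals: 237718/(27 · 50³) · (40/41)³ is about 0.0654, above 13/200 = 0.065.
  (≤ᵇ⇒≤ (13 * 27 * cube 50 * cube 41) (200 * cube 40 * 237718) _)

theorem4 : Σ[ A ∈ Pred ℕ 0ℓ ] IsPositiveSet A × IsSidon A ×
    (Σ[ A+A+A? ∈ Decidable (ThreefoldSumset A) ]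
    + 64 / 1000 <ᴸ lowerDensity A+A+A?)
theorem4 = A , A-positive , A-sidon , sumset? ,
  -- The tail bound 13/200 lies strictly above 64/1000, as `liminf` demands; index `k` stands for n
  -- = `suc k`.
  + 13 / 200 , toWitness {a? = + 64 / 1000 ℚ.<? + 13 / 200} _ , cube (50 * 40) , λ k N≤k →
    /-mono-≤ 13 199 (count sumset? (suc k)) k (sumset-dense (suc k) (m≤n⇒m≤1+n N≤k))
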